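{- Let $X$ be a recursively presented Polish space. There is a recursive map $u^X_f:2\times\omega\times\omega^\omega\to\omega^\omega$ such that for each $(\xi,a,n,\gamma)\in(\omega_1\setminus\{0\})\times2\times\omega\times\omega^\omega$: (a) If $(\gamma)_i\in BC_1\cup BC_\xi$ for each $i\le n$, then $u^X_f(a,n,\gamma)\in BC_1\cup BC_\xi$. Moreover, the equalities $\rho^X[u^X_f(0,n,\gamma)]=\bigcap_{i\le n}\rho^X[(\gamma)_i]$ and $\rho^X[u^X_f(1,n,\gamma)]=\bigcup_{i\le n}\rho^X[(\gamma)_i]$ hold. (b) If moreover $\xi\ge2$ and $(\gamma)_i\in BC_\xi$ for some $i\le n$, then $u^X_f(a,n,\gamma)\in BC_\xi$.
   Context: $2=\{0,1\}$. For $\gamma\in\omega^\omega$ and $i\in\omega$, $(\gamma)_i\in\omega^\omega$ is defined by $(\gamma)_i(j):=\gamma(2^i(2j+1)-1)$. Effective notions (recursively presented Polish spaces, recursive functions) are those of Moschovakis' book "Descriptive Set Theory". Each recursively presented Polish space $X$ has its standard effective enumeration $(N(X,k))_{k\in\omega}$ of a neighbourhood basis (possibly with empty sets; $N(X,0)=\emptyset$). $X$ is of type at most $1$ if it is a finite product of spaces equal to $\omega$, $\omega^\omega$ or $2^\omega$. $B\in\Sigma^0_1(X)$ iff $B=\bigcup_{i}N(X,\varepsilon(i))$ for some recursive $\varepsilon:\omega\to\omega$. A map $f:X\to Y$ is recursive if $\{(x,k)\mid f(x)\in N(Y,k)\}\in\Sigma^0_1(X\times\omega)$. Fix a good parametrization: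 sets $G^X\in\Sigma^0_1(\omega^\omega\times X)$, one for each recursively presented Polish $X$, such that $P\subseteq X$ is open iff $P=G^X_\gamma$ for some $\gamma\in\omega^\omega$, $P$ is $\Sigma^0_1$ iff $P=G^X_\gamma$ for some recursive $\gamma$, and for $X$ of type at most 1 and any $Y$ there is a recursive $S^{X,Y}:\omega^\omega\times X\to\omega^\omega$ with $(\gamma,x,y)\in G^{X\times Y}\Leftrightarrow(S^{X,Y}(\gamma,x),y)\in G^Y$. For $\gamma\in\omega^\omega$, $\{\gamma\}^{X,Y}$ is the partial function from $X$ to $Y$ with $\{\gamma\}^{X,Y}(x)$ defined and equal to $y$ iff $y$ is the (unique) point with $\forall k\,[y\in N(Y,k)\Leftrightarrow(\gamma,x,k)\in G^{X\times\omega}]$; write $\{\gamma\}$ when $Y=\omega^\omega$. Borel codes: let $\gamma^*(i):=\gamma(i+1)$. $BC_1:=\{\gamma\in\omega^\omega\mid\gamma(0)=0\}$ and for $2\le\xi<\omega_1$, $BC_\xi:=\{\gamma\in\omega^\omega\mid\gamma(0)=1$ and $\forall i\in\omega$, $\{\gamma^*\}(i)$ is defined and in $\bigcup_{1\le\eta<\xi}BC_\eta\}$; $BC:=\bigcup_{1\le\xi<\omega_1}BC_\xi$. For $\gamma\in BC$, $\rho^X(\gamma):=\bigcup_iN(X,\gamma^*(i))$ if $\gamma\in BC_1$, and $\rho^X(\gamma):=\bigcup_iX\setminus\rho^X(\{\gamma^*\}(i))$ otherwise. -}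

module Defs where

open import Level using (0ℓ)
open import Data.Empty using (⊥; ⊥-elim)
open import Data.Fin as Fin using (Fin; zero; suc; toℕ)
open import Data.Fin.Patterns using (0F; 1F; 2F; 3F)
import Data.Fin.Properties as Fin
open import Data.Integer as ℤ using (+_)
import Data.Integer.Properties as ℤ
open import Data.Nat as ℕ using (ℕ; zero; suc; _+_; _*_; _∸_; _^_; _≤_; _<_; _⊔_; pred; z≤n; s≤s)
open import Data.Nat.Properties as ℕ using ()
open import Data.Product using (Σ-syntax; ∃-syntax; _×_; _,_; proj₁; proj₂)
open import Data.Rational.Unnormalised as ℚ using (ℚᵘ; mkℚᵘ; 0ℚᵘ; 1ℚᵘ; *<*)
import Data.Rational.Unnormalised.Properties as ℚ
open import Data.Sum using (_⊎_; inj₁; inj₂)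
open import Data.Unit using (⊤; tt)
open import Data.Vec using (Vec; []; _∷_; lookup; tabulate)
open import Data.Vec.Properties using (tabulate∘lookup)
open import Function using (_∘_; id)
open import Function.Bundles using (_⇔_; mk⇔; module Equivalence)
open import Relation.Binary.Definitions using (DecidableEquality)
open import Relation.Binary.PropositionalEquality using (_≡_; _≢_; refl; sym; trans; cong; cong₂; subst; subst₂)
open import Relation.Nullary using (¬_; Dec; yes; no)
open import Relation.Nullary.Decidable using (decidable-stable)
open import Relation.Unary using (Pred; _∈_; _≐_; ⋃; ∁)

------------------------------------------------------------------------
-- Recursive functions and relations on ℕ

-- The least class of total functions ℕᵏ → ℕ containing the constants, the
-- successor and the projections and closed under composition, primitive
-- recursion and minimalization (of functions having a zero in every
-- section).  A Vec is an argument tuple.  The class is closed under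
-- pointwise equality because function extensionality is not available.

data Recursive : ∀ {k} → (Vec ℕ k → ℕ) → Set where
  const   : ∀ {k} c → Recursive {k} (λ _ → c)
  succ    : Recursive {1} (λ v → suc (lookup v 0F))
  proj    : ∀ {k} (i : Fin k) → Recursive (λ v → lookup v i)
  comp    : ∀ {k l} {f : Vec ℕ l → ℕ} {g : Fin l → Vec ℕ k → ℕ} →
            Recursive f → (∀ i → Recursive (g i)) →
            Recursive (λ v → f (tabulate (λ i → g i v)))
  primrec : ∀ {k} {f : Vec ℕ k → ℕ} {g : Vec ℕ (2 + k) → ℕ} {h : Vec ℕ (1 + k) → ℕ} →
            Recursive f → Recursive g →
            (∀ v → h (0 ∷ v) ≡ f v) →
            (∀ n v → h (suc n ∷ v) ≡ g (n ∷ h (n ∷ v) ∷ v)) →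
            Recursive h
  minim   : ∀ {k} {f : Vec ℕ (1 + k) → ℕ} {h : Vec ℕ k → ℕ} →
            Recursive f →
            (∀ v → f (h v ∷ v) ≡ 0) →
            (∀ v m → m < h v → f (m ∷ v) ≢ 0) →
            Recursive h
  ext     : ∀ {k} {f g : Vec ℕ k → ℕ} → (∀ v → f v ≡ g v) → Recursive f → Recursive g

Recursive₁ : (ℕ → ℕ) → Set
Recursive₁ f = Recursive {1} (λ v → f (lookup v 0F))

Recursive₂ : (ℕ → ℕ → ℕ) → Set
Recursive₂ f = Recursive {2} (λ v → f (lookup v 0F) (lookup v 1F))

RecursiveRel : ∀ {k} → Pred (Vec ℕ k) 0ℓ → Set
RecursiveRel {k} P = Σ[ χ ∈ (Vec ℕ k → ℕ) ] Recursive χ ×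
  (∀ v → (P v × χ v ≡ 1) ⊎ (¬ P v × χ v ≡ 0))

private
  variable
    k l : ℕ

comp₁ : ∀ f {a : Vec ℕ k → ℕ} → Recursive₁ f → Recursive a → Recursive (λ v → f (a v))
comp₁ _ {a} rf ra = comp {g = λ _ → a} rf (λ _ → ra)

comp₂ : ∀ f {a b : Vec ℕ k → ℕ} → Recursive₂ f → Recursive a → Recursive b →
        Recursive (λ v → f (a v) (b v))
comp₂ _ {a} {b} rf ra rb =
  comp {g = λ { 0F → a ; 1F → b }} rf (λ { 0F → ra ; 1F → rb })

+-rec : Recursive₂ _+_
+-rec = primrec (proj 0F) (comp₁ suc succ (proj 1F)) (λ { (_ ∷ []) → refl }) (λ { _ (_ ∷ []) → refl })

*-rec : Recursive₂ _*_
*-rec = primrec (const 0) (comp₂ _+_ +-rec (proj 2F) (proj 1F)) (λ { (_ ∷ []) → refl }) (λ { _ (_ ∷ []) → refl })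

pred-rec : Recursive₁ pred
pred-rec = primrec {f = λ _ → 0} (const 0) (proj 0F) (λ _ → refl) (λ _ _ → refl)

∸-rec : Recursive₂ _∸_
∸-rec = comp₂ (λ n m → m ∸ n)
  (primrec (proj 0F) (comp₁ pred pred-rec (proj 1F)) (λ { (_ ∷ []) → refl })
    (λ { n (m ∷ []) → sym (ℕ.pred[m∸n]≡m∸[1+n] m n) }))
  (proj 1F) (proj 0F)

≤ᴿ : {a b : Vec ℕ k → ℕ} → Recursive a → Recursive b → RecursiveRel (λ v → a v ≤ b v)
≤ᴿ {a = a} {b} ra rb = _ , comp₂ _∸_ ∸-rec (const 1) (comp₂ _∸_ ∸-rec ra rb) , λ v → spec (a v) (b v)
  where
  spec : ∀ m n → (m ≤ n × 1 ∸ (m ∸ n) ≡ 1) ⊎ (¬ m ≤ n × 1 ∸ (m ∸ n) ≡ 0)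
  spec zero    n       = inj₁ (z≤n , cong (1 ∸_) (ℕ.0∸n≡0 n))
  spec (suc m) zero    = inj₂ ((λ ()) , ℕ.0∸n≡0 m)
  spec (suc m) (suc n) with spec m n
  ... | inj₁ (p , e) = inj₁ (s≤s p , e)
  ... | inj₂ (p , e) = inj₂ (p ∘ ℕ.≤-pred , e)

module _ {P Q : Pred (Vec ℕ k) 0ℓ} where

  ⇔ᴿ : (∀ v → P v ⇔ Q v) → RecursiveRel P → RecursiveRel Q
  ⇔ᴿ P⇔Q (χ , r , s) = χ , r , λ v → spec v (s v)
    where
    spec : ∀ v → (P v × χ v ≡ 1) ⊎ (¬ P v × χ v ≡ 0) → (Q v × χ v ≡ 1) ⊎ (¬ Q v × χ v ≡ 0)
    spec v (inj₁ (p , e)) = inj₁ (Equivalence.to (P⇔Q v) p , e)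
    spec v (inj₂ (p , e)) = inj₂ (p ∘ Equivalence.from (P⇔Q v) , e)

  ∧ᴿ : RecursiveRel P → RecursiveRel Q → RecursiveRel (λ v → P v × Q v)
  ∧ᴿ (χ , r , s) (ψ , r′ , s′) = _ , comp₂ _*_ *-rec r r′ , λ v → spec v (s v) (s′ v)
    where
    spec : ∀ v → (P v × χ v ≡ 1) ⊎ (¬ P v × χ v ≡ 0) → (Q v × ψ v ≡ 1) ⊎ (¬ Q v × ψ v ≡ 0) →
           ((P v × Q v) × χ v * ψ v ≡ 1) ⊎ (¬ (P v × Q v) × χ v * ψ v ≡ 0)
    spec v (inj₁ (p , e)) (inj₁ (q , e′)) = inj₁ ((p , q) , cong₂ _*_ e e′)
    spec v (inj₁ (p , e)) (inj₂ (q , e′)) = inj₂ (q ∘ proj₂ , trans (cong (χ v *_) e′) (ℕ.*-zeroʳ (χ v)))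
    spec v (inj₂ (p , e)) _               = inj₂ (p ∘ proj₁ , cong (_* ψ v) e)

¬ᴿ : {P : Pred (Vec ℕ k) 0ℓ} → RecursiveRel P → RecursiveRel (λ v → ¬ P v)
¬ᴿ {P = P} (χ , r , s) = _ , comp₂ _∸_ ∸-rec (const 1) r , λ v → spec v (s v)
  where
  spec : ∀ v → (P v × χ v ≡ 1) ⊎ (¬ P v × χ v ≡ 0) →
         (¬ P v × 1 ∸ χ v ≡ 1) ⊎ (¬ ¬ P v × 1 ∸ χ v ≡ 0)
  spec v (inj₁ (p , e)) = inj₂ ((λ np → np p) , cong (1 ∸_) e)
  spec v (inj₂ (p , e)) = inj₁ (p , cong (1 ∸_) e)

RecursiveRel⇒Dec : {P : Pred (Vec ℕ k) 0ℓ} → RecursiveRel P → ∀ v → Dec (P v)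
RecursiveRel⇒Dec (_ , _ , s) v with s v
... | inj₁ (p , _) = yes p
... | inj₂ (p , _) = no p

→ᴿ : {P Q : Pred (Vec ℕ k) 0ℓ} → RecursiveRel P → RecursiveRel Q → RecursiveRel (λ v → P v → Q v)
→ᴿ rP rQ = ⇔ᴿ
  (λ v → mk⇔ (λ n p → decidable-stable (RecursiveRel⇒Dec rQ v) (λ nq → n (p , nq)))
             (λ f pn → proj₂ pn (f (proj₁ pn))))
  (¬ᴿ (∧ᴿ rP (¬ᴿ rQ)))

≡ᴿ : {a b : Vec ℕ k → ℕ} → Recursive a → Recursive b → RecursiveRel (λ v → a v ≡ b v)
≡ᴿ ra rb = ⇔ᴿ
  (λ v → mk⇔ (λ p → ℕ.≤-antisym (proj₁ p) (proj₂ p)) (λ e → ℕ.≤-reflexive e , ℕ.≤-reflexive (sym e)))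
  (∧ᴿ (≤ᴿ ra rb) (≤ᴿ rb ra))

substᴿ : {P : Pred (Vec ℕ l) 0ℓ} {g : Fin l → Vec ℕ k → ℕ} →
         RecursiveRel P → (∀ i → Recursive (g i)) → RecursiveRel (λ v → P (tabulate (λ i → g i v)))
substᴿ (χ , r , s) rg = _ , comp r rg , λ v → s _

∀<ᴿ : {P : Pred (Vec ℕ (1 + k)) 0ℓ} {b : Vec ℕ k → ℕ} → RecursiveRel P → Recursive b →
      RecursiveRel (λ v → ∀ n → n < b v → P (n ∷ v))
∀<ᴿ {k} {P} {b} (χ , r , s) rb =
  (λ v → all (b v ∷ v)) ,
  ext (λ v → cong (λ w → all (b v ∷ w)) (tabulate∘lookup v))
      (comp {g = λ { zero → b ; (suc i) v → lookup v i }} all-rec (λ { zero → rb ; (suc i) → proj i })) ,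
  (λ v → spec v (b v))
  where
  all : Vec ℕ (1 + k) → ℕ
  all (zero  ∷ v) = 1
  all (suc n ∷ v) = all (n ∷ v) * χ (n ∷ v)

  all-rec : Recursive all
  all-rec = primrec (const 1)
    (comp₂ _*_ *-rec (proj 1F)
      (comp {g = λ { zero v → lookup v 0F ; (suc i) v → lookup v (suc (suc i)) }} r
            (λ { zero → proj 0F ; (suc i) → proj (suc (suc i)) })))
    (λ _ → refl)
    (λ n v → cong (λ w → all (n ∷ v) * χ (n ∷ w)) (sym (tabulate∘lookup v)))

  spec : ∀ v m → ((∀ n → n < m → P (n ∷ v)) × all (m ∷ v) ≡ 1) ⊎
                 (¬ (∀ n → n < m → P (n ∷ v)) × all (m ∷ v) ≡ 0)
  spec v zero = inj₁ ((λ _ ()) , refl)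
  spec v (suc m) with spec v m | s (m ∷ v)
  ... | inj₂ (p , e) | _ = inj₂ ((λ h → p (λ n n<m → h n (ℕ.m<n⇒m<1+n n<m))) , cong (_* χ (m ∷ v)) e)
  ... | inj₁ (p , e) | inj₂ (q , e′) =
    inj₂ ((λ h → q (h m ℕ.≤-refl)) , trans (cong (all (m ∷ v) *_) e′) (ℕ.*-zeroʳ (all (m ∷ v))))
  ... | inj₁ (p , e) | inj₁ (q , e′) = inj₁ (below , cong₂ _*_ e e′)
    where
    below : ∀ n → n < suc m → P (n ∷ v)
    below n n<1+m with ℕ.m≤n⇒m<n∨m≡n (ℕ.≤-pred n<1+m)
    ... | inj₁ n<m  = p n n<m
    ... | inj₂ refl = q

------------------------------------------------------------------------
-- Coding of finite sequences

tri : ℕ → ℕ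
tri zero    = 0
tri (suc n) = suc n + tri n

-- The Cantor pairing function and its inverse.  diag s is the largest w
-- with tri w ≤ s.

⟨_,_⟩ : ℕ → ℕ → ℕ
⟨ a , b ⟩ = tri (a + b) + b

diag : ℕ → ℕ
diag zero    = 0
diag (suc s) = diag s + (1 ∸ (tri (suc (diag s)) ∸ suc s))

π₁ π₂ : ℕ → ℕ
π₂ s = s ∸ tri (diag s)
π₁ s = diag s ∸ π₂ s

rest : ℕ → ℕ → ℕ
rest zero    s = s
rest (suc n) s = π₂ (rest n s)

-- s at i is the i-th component (s)ᵢ of the sequence coded by s: writing
-- s = ⟨ s₀ , ⟨ s₁ , ⟨ s₂ , … ⟩ ⟩ ⟩, it is sᵢ.  Since ⟨ 0 , 0 ⟩ = 0, this is a
-- bijection of ℕ with the eventually zero sequences, and (0)ᵢ = 0.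

_at_ : ℕ → ℕ → ℕ
s at i = π₁ (rest i s)

tri-mono : ∀ {m n} → m ≤ n → tri m ≤ tri n
tri-mono z≤n       = z≤n
tri-mono (s≤s m≤n) = s≤s (ℕ.+-mono-≤ m≤n (tri-mono m≤n))

diag-bounds : ∀ s → tri (diag s) ≤ s × s < tri (suc (diag s))
diag-bounds zero = z≤n , s≤s z≤n
diag-bounds (suc s) with diag-bounds s | tri (suc (diag s)) ℕ.≤? suc s
... | lo , hi | yes t≤s rewrite ℕ.m≤n⇒m∸n≡0 t≤s | ℕ.+-comm (diag s) 1 =
  t≤s , ℕ.≤-<-trans hi (s≤s (ℕ.m≤n+m _ (suc (diag s))))
... | lo , hi | no t≰s rewrite ℕ.m≤n⇒m∸n≡0 (ℕ.m<n⇒0<n∸m (ℕ.≰⇒> t≰s)) | ℕ.+-identityʳ (diag s) =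
  ℕ.m≤n⇒m≤1+n lo , ℕ.≰⇒> t≰s

diag-unique : ∀ s w → tri w ≤ s → s < tri (suc w) → diag s ≡ w
diag-unique s w lo hi = ℕ.≤-antisym
  (ℕ.≮⇒≥ (λ w<d → ℕ.<⇒≱ hi (ℕ.≤-trans (tri-mono w<d) (proj₁ (diag-bounds s)))))
  (ℕ.≮⇒≥ (λ d<w → ℕ.<⇒≱ (proj₂ (diag-bounds s)) (ℕ.≤-trans (tri-mono d<w) lo)))

diag-⟨⟩ : ∀ a b → diag ⟨ a , b ⟩ ≡ a + b
diag-⟨⟩ a b = diag-unique _ _ (ℕ.m≤m+n _ b)
  (subst (_< tri (suc (a + b))) (ℕ.+-comm b _) (s≤s (ℕ.+-monoˡ-≤ _ (ℕ.m≤n+m b a))))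

π₂-⟨⟩ : ∀ a b → π₂ ⟨ a , b ⟩ ≡ b
π₂-⟨⟩ a b rewrite diag-⟨⟩ a b = ℕ.m+n∸m≡n (tri (a + b)) b

π₁-⟨⟩ : ∀ a b → π₁ ⟨ a , b ⟩ ≡ a
π₁-⟨⟩ a b rewrite π₂-⟨⟩ a b | diag-⟨⟩ a b = ℕ.m+n∸n≡m a b

π₂≤pred : ∀ s → π₂ s ≤ pred s
π₂≤pred zero    = z≤n
π₂≤pred (suc s) with diag (suc s) | proj₂ (diag-bounds (suc s))
... | zero  | s≤s ()
... | suc w | _ = ℕ.m∸n≤m s (w + tri w)

rest-≤ : ∀ n s → rest n s ≤ s ∸ n
rest-≤ zero    s = ℕ.≤-refl
rest-≤ (suc n) s = ℕ.≤-trans (π₂≤pred (rest n s))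
  (subst (pred (rest n s) ≤_) (ℕ.pred[m∸n]≡m∸[1+n] s n) (ℕ.pred-mono-≤ (rest-≤ n s)))

at-≥ : ∀ s n → s ≤ n → s at n ≡ 0
at-≥ s n s≤n = cong π₁ (ℕ.n≤0⇒n≡0 (ℕ.≤-trans (rest-≤ n s) (ℕ.≤-reflexive (ℕ.m≤n⇒m∸n≡0 s≤n))))

rest-suc : ∀ n s → rest (suc n) s ≡ rest n (π₂ s)
rest-suc zero    s = refl
rest-suc (suc n) s = cong π₂ (rest-suc n s)

-- The code of the sequence x 0 , … , x (n - 1) , 0 , 0 , …

encode : ℕ → (ℕ → ℕ) → ℕ
encode zero    x = 0
encode (suc n) x = ⟨ x 0 , encode n (x ∘ suc) ⟩

at-encode : ∀ n x i → i < n → encode n x at i ≡ x i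
at-encode (suc n) x zero    _         = π₁-⟨⟩ (x 0) _
at-encode (suc n) x (suc i) (s≤s i<n) =
  trans (cong π₁ (trans (rest-suc i (encode (suc n) x)) (cong (rest i) (π₂-⟨⟩ (x 0) _))))
        (at-encode n (x ∘ suc) i i<n)

tri-rec : Recursive₁ tri
tri-rec = primrec {f = λ _ → 0} (const 0) (comp₂ _+_ +-rec (comp₁ suc succ (proj 0F)) (proj 1F)) (λ _ → refl) (λ _ _ → refl)

diag-rec : Recursive₁ diag
diag-rec = primrec {f = λ _ → 0} (const 0)
  (comp₂ _+_ +-rec (proj 1F)
    (comp₂ _∸_ ∸-rec (const 1) (comp₂ _∸_ ∸-rec (comp₁ tri tri-rec (comp₁ suc succ (proj 1F))) (comp₁ suc succ (proj 0F)))))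
  (λ _ → refl) (λ _ _ → refl)

π₂-rec : Recursive₁ π₂
π₂-rec = comp₂ _∸_ ∸-rec (proj 0F) (comp₁ tri tri-rec (comp₁ diag diag-rec (proj 0F)))

π₁-rec : Recursive₁ π₁
π₁-rec = comp₂ _∸_ ∸-rec (comp₁ diag diag-rec (proj 0F)) (comp₁ π₂ π₂-rec (proj 0F))

rest-rec : Recursive₂ rest
rest-rec = primrec (proj 0F) (comp₁ π₂ π₂-rec (proj 1F)) (λ { (_ ∷ []) → refl }) (λ { _ (_ ∷ []) → refl })

at-rec : Recursive₂ _at_
at-rec = comp₁ π₁ π₁-rec (comp₂ rest rest-rec (proj 1F) (proj 0F))

------------------------------------------------------------------------
-- Nonnegative rationals and real numbers

infix 8 _/1+_

_/1+_ : ℕ → ℕ → ℚᵘ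
m /1+ k = mkℚᵘ (+ m) k

-- A nonnegative real number r is given by the set of all rationals q with
-- r < q.  Assuming excluded middle these sets are in bijection with the
-- nonnegative reals, and no lower cut is needed.  Inside the record,
-- _<ʳ_ q stands for r <ʳ q.

record ℝ≥0 : Set₁ where
  infix 4 _<ʳ_
  field
    _<ʳ_      : ℚᵘ → Set
    positive  : ∀ {q} → _<ʳ_ q → 0ℚᵘ ℚ.< q
    inhabited : ∃[ q ] _<ʳ_ q
    upward    : ∀ {p q} → _<ʳ_ p → p ℚ.≤ q → _<ʳ_ q
    rounded   : ∀ {q} → _<ʳ_ q → ∃[ p ] (p ℚ.< q × _<ʳ_ p)

open ℝ≥0 public using (_<ʳ_)

infix 4 _≤ʳ_

_≤ʳ_ : ℝ≥0 → ℚᵘ → Set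
r ≤ʳ q = ∀ p → q ℚ.< p → r <ʳ p

------------------------------------------------------------------------
-- Recursively presented Polish spaces

-- A separable complete metric space with a recursive presentation: a dense
-- sequence (pt i), repetitions allowed, such that the relations
-- d(pt i, pt j) < m/(k+1) and d(pt i, pt j) ≤ m/(k+1) are recursive.
--
-- Points at distance 0 are regarded as equal, so that no quotient is needed
-- (and sequences are equal when they are pointwise equal).

record PolishSpace : Set₁ where
  field
    Point    : Set
    d        : Point → Point → ℝ≥0
    d-refl   : ∀ x {q} → 0ℚᵘ ℚ.< q → d x x <ʳ q
    d-sym    : ∀ x y {q} → d x y <ʳ q → d y x <ʳ q
    d-tri    : ∀ x y z {p q} → d x y <ʳ p → d y z <ʳ q → d x z <ʳ p ℚ.+ q
    complete : (x : ℕ → Point) →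
               (∀ ε → 0ℚᵘ ℚ.< ε → ∃[ N ] (∀ m n → N ≤ m → N ≤ n → d (x m) (x n) <ʳ ε)) →
               ∃[ y ] (∀ ε → 0ℚᵘ ℚ.< ε → ∃[ N ] (∀ n → N ≤ n → d (x n) y <ʳ ε))
    pt       : ℕ → Point
    dense    : ∀ x ε → 0ℚᵘ ℚ.< ε → ∃[ i ] d x (pt i) <ʳ ε
    <-rec    : RecursiveRel {4} (λ { (i ∷ j ∷ m ∷ k ∷ []) → d (pt i) (pt j) <ʳ m /1+ k })
    ≤-rec    : RecursiveRel {4} (λ { (i ∷ j ∷ m ∷ k ∷ []) → d (pt i) (pt j) ≤ʳ m /1+ k })

open PolishSpace public using (Point)

------------------------------------------------------------------------
-- Discrete spaces and spaces of sequences

/1+-<⁺ : ∀ {m k m′ k′} → m * suc k′ < m′ * suc k → m /1+ k ℚ.< m′ /1+ k′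
/1+-<⁺ {m} {k} {m′} {k′} h = *<* (subst₂ ℤ._<_ (ℤ.pos-* m (suc k′)) (ℤ.pos-* m′ (suc k)) (ℤ.+<+ h))

/1+-<⁻ : ∀ {m k m′ k′} → m /1+ k ℚ.< m′ /1+ k′ → m * suc k′ < m′ * suc k
/1+-<⁻ {m} {k} {m′} {k′} (*<* h) =
  ℤ.drop‿+<+ (subst₂ ℤ._<_ (sym (ℤ.pos-* m (suc k′))) (sym (ℤ.pos-* m′ (suc k))) h)

/1+-≤⁺ : ∀ {m k m′ k′} → m * suc k′ ≤ m′ * suc k → m /1+ k ℚ.≤ m′ /1+ k′
/1+-≤⁺ h = ℚ.≮⇒≥ (λ h′ → ℕ.<⇒≱ (/1+-<⁻ h′) h)

0<1/1+ : ∀ n → 0ℚᵘ ℚ.< 1 /1+ n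
0<1/1+ n = /1+-<⁺ (s≤s z≤n)

0≤/1+ : ∀ m k → 0ℚᵘ ℚ.≤ m /1+ k
0≤/1+ m k = /1+-≤⁺ z≤n

1/1+-anti : ∀ {m n} → m ≤ n → 1 /1+ n ℚ.≤ 1 /1+ m
1/1+-anti m≤n = /1+-≤⁺ (s≤s (ℕ.+-monoˡ-≤ 0 m≤n))

archimedean : ∀ q → 0ℚᵘ ℚ.< q → ∃[ n ] 1 /1+ n ℚ.< q
archimedean (mkℚᵘ (+ zero)  k) (*<* (ℤ.+<+ ()))
archimedean (mkℚᵘ (+ suc m) k) _ = suc k ,
  /1+-<⁺ {1} {suc k} {suc m} {k} (subst (_< suc m * suc (suc k)) (sym (ℕ.+-identityʳ (suc k)))
    (ℕ.m≤m+n (suc (suc k)) (m * suc (suc k))))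

<⇒<+ˡ : ∀ {r p q} → 0ℚᵘ ℚ.< q → r ℚ.< p → r ℚ.< p ℚ.+ q
<⇒<+ˡ {r} {p} {q} 0<q r<p = ℚ.<-respˡ-≃ (ℚ.+-identityʳ r) (ℚ.+-mono-< r<p 0<q)

<⇒<+ʳ : ∀ {r p q} → 0ℚᵘ ℚ.< p → r ℚ.< q → r ℚ.< p ℚ.+ q
<⇒<+ʳ {r} {p} {q} 0<p r<q = ℚ.<-respˡ-≃ (ℚ.+-identityˡ r) (ℚ.+-mono-< 0<p r<q)

⊔-< : ∀ {p q r} → p ℚ.< r → q ℚ.< r → p ℚ.⊔ q ℚ.< r
⊔-< {p} {q} p<r q<r with ℚ.≤-total p q
... | inj₁ p≤q = ℚ.<-respˡ-≃ (ℚ.≃-sym (ℚ.p≤q⇒p⊔q≃q p≤q)) q<r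
... | inj₂ q≤p = ℚ.<-respˡ-≃ (ℚ.≃-sym (ℚ.p≥q⇒p⊔q≃p q≤p)) p<r

-- A countable set with a surjection from ℕ whose equality kernel is
-- recursive.

record CodedSet : Set₁ where
  field
    Carrier : Set
    _≟_     : DecidableEquality Carrier
    elt     : ℕ → Carrier
    code    : Carrier → ℕ
    elt∘code : ∀ a → elt (code a) ≡ a
    ≡-rec   : RecursiveRel {2} (λ { (i ∷ j ∷ []) → elt i ≡ elt j })

ℕ-coded : CodedSet
ℕ-coded = record
  { Carrier = ℕ ; _≟_ = ℕ._≟_ ; elt = id ; code = id ; elt∘code = λ _ → refl
  ; ≡-rec = ⇔ᴿ (λ { (i ∷ j ∷ []) → mk⇔ id id }) (≡ᴿ (proj 0F) (proj 1F))
  }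

2-coded : CodedSet
2-coded = record
  { Carrier = Fin 2 ; _≟_ = Fin._≟_ ; elt = bit ; code = toℕ
  ; elt∘code = λ { 0F → refl ; 1F → refl }
  ; ≡-rec = ⇔ᴿ (λ { (i ∷ j ∷ []) → mk⇔ (to i j) (from i j) })
      (≡ᴿ (comp₂ _∸_ ∸-rec (const 1) (proj 0F)) (comp₂ _∸_ ∸-rec (const 1) (proj 1F)))
  }
  where
  bit : ℕ → Fin 2
  bit zero    = 0F
  bit (suc _) = 1F

  to : ∀ i j → 1 ∸ i ≡ 1 ∸ j → bit i ≡ bit j
  to zero    zero    _ = refl
  to zero    (suc j) e with () ← trans e (ℕ.0∸n≡0 j)
  to (suc i) zero    e with () ← trans (sym e) (ℕ.0∸n≡0 i)
  to (suc i) (suc j) _ = refl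

  from : ∀ i j → bit i ≡ bit j → 1 ∸ i ≡ 1 ∸ j
  from zero    zero    _ = refl
  from (suc i) (suc j) _ = trans (ℕ.0∸n≡0 i) (sym (ℕ.0∸n≡0 j))

module _ (A : CodedSet) where
  open CodedSet A

  ≡ᶜ : {a b : Vec ℕ k → ℕ} → Recursive a → Recursive b → RecursiveRel (λ v → elt (a v) ≡ elt (b v))
  ≡ᶜ {a = a} {b} ra rb = substᴿ {g = λ { 0F → a ; 1F → b }} ≡-rec (λ { 0F → ra ; 1F → rb })

  -- d(x,y) = 1 if x ≠ y, and 0 otherwise.

  discrete : PolishSpace
  discrete = record
    { Point    = Carrier
    ; d        = dist
    ; d-refl   = λ x 0<q → 0<q , λ x≢x → ⊥-elim (x≢x refl)
    ; d-sym    = λ x y h → proj₁ h , λ y≢x → proj₂ h (y≢x ∘ sym)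
    ; d-tri    = tri≤
    ; complete = λ x cauchy → let N , h = cauchy 1ℚᵘ (0<1/1+ 0) in
        x N , λ ε 0<ε → N , λ n N≤n → 0<ε , λ xn≢xN → ⊥-elim
          (ℚ.<-irrefl ℚ.≃-refl (proj₂ (h n N N≤n ℕ.≤-refl) xn≢xN))
    ; pt       = elt
    ; dense    = λ x ε 0<ε → code x , 0<ε , λ h → ⊥-elim (h (sym (elt∘code x)))
    ; <-rec    = ⇔ᴿ (λ { (i ∷ j ∷ m ∷ k ∷ []) → mk⇔
        (λ h → /1+-<⁺ (ℕ.≤-trans (proj₁ h) (ℕ.m≤m*n m 1)) ,
               λ n → /1+-<⁺ (subst₂ _<_ (sym (ℕ.*-identityˡ (suc k))) (sym (ℕ.*-identityʳ m)) (proj₂ h n)))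
        (λ h → subst (1 ≤_) (ℕ.*-identityʳ m) (/1+-<⁻ (proj₁ h)) ,
               λ n → subst₂ _<_ (ℕ.*-identityˡ (suc k)) (ℕ.*-identityʳ m) (/1+-<⁻ (proj₂ h n))) })
        (∧ᴿ (≤ᴿ (const 1) (proj 2F))
            (→ᴿ (¬ᴿ (≡ᶜ (proj 0F) (proj 1F))) (≤ᴿ (comp₁ suc succ (comp₁ suc succ (proj 3F))) (proj 2F))))
    ; ≤-rec    = ⇔ᴿ (λ { (i ∷ j ∷ m ∷ k ∷ []) → mk⇔
        (λ h p q<p → ℚ.≤-<-trans (0≤/1+ m k) q<p ,
               λ n → ℚ.≤-<-trans (/1+-≤⁺ (subst₂ _≤_ (sym (ℕ.*-identityˡ (suc k))) (sym (ℕ.*-identityʳ m)) (h n))) q<p)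
        (λ h n → ℕ.≮⇒≥ (λ m<1+k → ℚ.<-irrefl ℚ.≃-refl
               (proj₂ (h 1ℚᵘ (/1+-<⁺ (subst₂ _<_ (sym (ℕ.*-identityʳ m)) (sym (ℕ.*-identityˡ (suc k))) m<1+k))) n))) })
        (→ᴿ (¬ᴿ (≡ᶜ (proj 0F) (proj 1F))) (≤ᴿ (comp₁ suc succ (proj 3F)) (proj 2F)))
    }
    where
    dist : Carrier → Carrier → ℝ≥0
    dist x y = record
      { _<ʳ_      = λ q → 0ℚᵘ ℚ.< q × (x ≢ y → 1ℚᵘ ℚ.< q)
      ; positive  = proj₁
      ; inhabited = 2 /1+ 0 , /1+-<⁺ (s≤s z≤n) , λ _ → /1+-<⁺ (s≤s (s≤s z≤n))
      ; upward    = λ h p≤q → ℚ.<-≤-trans (proj₁ h) p≤q , λ n → ℚ.<-≤-trans (proj₂ h n) p≤q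
      ; rounded   = λ {q} → rnd q
      }
      where
      rnd : ∀ q → 0ℚᵘ ℚ.< q × (x ≢ y → 1ℚᵘ ℚ.< q) →
            ∃[ p ] (p ℚ.< q × 0ℚᵘ ℚ.< p × (x ≢ y → 1ℚᵘ ℚ.< p))
      rnd q (0<q , h) with x ≟ y
      ... | yes x≡y = let p , 0<p , p<q = ℚ.<-dense 0<q in p , p<q , 0<p , λ x≢y → ⊥-elim (x≢y x≡y)
      ... | no x≢y  = let p , 1<p , p<q = ℚ.<-dense (h x≢y) in
        p , p<q , ℚ.<-trans (0<1/1+ 0) 1<p , λ _ → 1<p

    tri≤ : ∀ x y z {p q} → dist x y <ʳ p → dist y z <ʳ q → dist x z <ʳ p ℚ.+ q
    tri≤ x y z (0<p , h) (0<q , h′) = <⇒<+ˡ 0<q 0<p , far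
      where
      far : x ≢ z → 1ℚᵘ ℚ.< _
      far x≢z with x ≟ y
      ... | no x≢y   = <⇒<+ˡ 0<q (h x≢y)
      ... | yes refl = <⇒<+ʳ 0<p (h′ x≢z)

  -- d(α,β) = 1/(n+1) for the least n with α(n) ≠ β(n), and 0 if there is
  -- none; equivalently, d(α,β) is the supremum of all 1/(n+1) with
  -- α(n) ≠ β(n).  The dense sequence consists of the sequences
  -- n ↦ elt (s)ₙ, which are eventually constant.

  sequences : PolishSpace
  sequences = record
    { Point    = ℕ → Carrier
    ; d        = dist
    ; d-refl   = λ x 0<q → 0<q , λ n x≢x → ⊥-elim (x≢x refl)
    ; d-sym    = λ x y h → proj₁ h , λ n y≢x → proj₂ h n (y≢x ∘ sym)
    ; d-tri    = tri≤
    ; complete = lim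
    ; pt       = λ s n → elt (s at n)
    ; dense    = λ x ε 0<ε → let N , 1/N<ε = archimedean ε 0<ε in
        encode N (code ∘ x) , 0<ε , λ n x≢s → near 1/N<ε n (λ n<N → x≢s
          (sym (trans (cong elt (at-encode N (code ∘ x) n n<N)) (elt∘code (x n)))))
    ; <-rec    = ⇔ᴿ (λ { (i ∷ j ∷ m ∷ k ∷ []) → mk⇔
        (λ h → /1+-<⁺ (ℕ.≤-trans (proj₁ h) (ℕ.m≤m*n m 1)) ,
               λ n ne → /1+-<⁺ (subst (_< m * suc n) (sym (ℕ.*-identityˡ (suc k))) (proj₂ h n (below i j n ne) ne)))
        (λ h → subst (1 ≤_) (ℕ.*-identityʳ m) (/1+-<⁻ (proj₁ h)) ,
               λ n _ ne → subst (_< m * suc n) (ℕ.*-identityˡ (suc k)) (/1+-<⁻ (proj₂ h n ne))) })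
        (∧ᴿ (≤ᴿ (const 1) (proj 2F))
            (∀<ᴿ (→ᴿ differ (≤ᴿ (comp₁ suc succ (comp₁ suc succ (proj (suc 3F)))) product)) bound))
    ; ≤-rec    = ⇔ᴿ (λ { (i ∷ j ∷ m ∷ k ∷ []) → mk⇔
        (λ h p q<p → ℚ.≤-<-trans (0≤/1+ m k) q<p ,
               λ n ne → ℚ.≤-<-trans (/1+-≤⁺ (subst (_≤ m * suc n) (sym (ℕ.*-identityˡ (suc k)))
                          (h n (below i j n ne) ne))) q<p)
        (λ h n _ ne → ℕ.≮⇒≥ (λ lt → ℚ.<-irrefl ℚ.≃-refl
               (proj₂ (h (1 /1+ n) (/1+-<⁺ (subst (m * suc n <_) (sym (ℕ.*-identityˡ (suc k))) lt))) n ne))) })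
        (∀<ᴿ (→ᴿ differ (≤ᴿ (comp₁ suc succ (proj (suc 3F))) product)) bound)
    }
    where
    Below : (α β : ℕ → Carrier) → ℚᵘ → Set
    Below α β q = 0ℚᵘ ℚ.< q × (∀ n → α n ≢ β n → 1 /1+ n ℚ.< q)

    near : ∀ {N ε} → 1 /1+ N ℚ.< ε → ∀ n → ¬ n < N → 1 /1+ n ℚ.< ε
    near 1/N<ε n n≮N = ℚ.≤-<-trans (1/1+-anti (ℕ.≮⇒≥ n≮N)) 1/N<ε

    dist : (α β : ℕ → Carrier) → ℝ≥0
    dist α β = record
      { _<ʳ_      = Below α β
      ; positive  = proj₁
      ; inhabited = 2 /1+ 0 , /1+-<⁺ (s≤s z≤n) , λ n _ → ℚ.≤-<-trans (1/1+-anti {0} {n} z≤n) (/1+-<⁺ (s≤s (s≤s z≤n)))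
      ; upward    = λ h p≤q → ℚ.<-≤-trans (proj₁ h) p≤q , λ n ne → ℚ.<-≤-trans (proj₂ h n ne) p≤q
      ; rounded   = rnd
      }
      where
      upTo : ∀ {q} → Below α β q → ∀ N → ∃[ p ] (p ℚ.< q × 0ℚᵘ ℚ.< p × (∀ n → n < N → α n ≢ β n → 1 /1+ n ℚ.< p))
      upTo (0<q , h) zero = let p , 0<p , p<q = ℚ.<-dense 0<q in p , p<q , 0<p , λ _ ()
      upTo (0<q , h) (suc N) with upTo (0<q , h) N | α N ≟ β N
      ... | p , p<q , 0<p , below | yes αN≡βN = p , p<q , 0<p , below′
        where
        below′ : ∀ n → n < suc N → α n ≢ β n → 1 /1+ n ℚ.< p
        below′ n n<1+N ne with ℕ.m≤n⇒m<n∨m≡n (ℕ.≤-pred n<1+N)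
        ... | inj₁ n<N  = below n n<N ne
        ... | inj₂ refl = ⊥-elim (ne αN≡βN)
      ... | p , p<q , 0<p , below | no αN≢βN with ℚ.<-dense (h N αN≢βN)
      ...   | p′ , 1/N<p′ , p′<q = p ℚ.⊔ p′ , ⊔-< p<q p′<q , ℚ.<-≤-trans 0<p (ℚ.p≤p⊔q p p′) , below′
        where
        below′ : ∀ n → n < suc N → α n ≢ β n → 1 /1+ n ℚ.< p ℚ.⊔ p′
        below′ n n<1+N ne with ℕ.m≤n⇒m<n∨m≡n (ℕ.≤-pred n<1+N)
        ... | inj₁ n<N  = ℚ.<-≤-trans (below n n<N ne) (ℚ.p≤p⊔q p p′)
        ... | inj₂ refl = ℚ.<-≤-trans 1/N<p′ (ℚ.p≤q⊔p p p′)

      rnd : ∀ {q} → Below α β q → ∃[ p ] (p ℚ.< q × Below α β p)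
      rnd {q} h with archimedean q (proj₁ h)
      ... | N , 1/N<q with upTo h N | ℚ.<-dense 1/N<q
      ... | p , p<q , 0<p , below | p′ , 1/N<p′ , p′<q =
        p ℚ.⊔ p′ , ⊔-< p<q p′<q , ℚ.<-≤-trans 0<p (ℚ.p≤p⊔q p p′) , all
        where
        all : ∀ n → α n ≢ β n → 1 /1+ n ℚ.< p ℚ.⊔ p′
        all n ne with n ℕ.<? N
        ... | yes n<N = ℚ.<-≤-trans (below n n<N ne) (ℚ.p≤p⊔q p p′)
        ... | no n≮N  = ℚ.<-≤-trans (near 1/N<p′ n n≮N) (ℚ.p≤q⊔p p p′)

    tri≤ : ∀ α β γ {p q} → Below α β p → Below β γ q → Below α γ (p ℚ.+ q)
    tri≤ α β γ (0<p , h) (0<q , h′) = <⇒<+ˡ 0<q 0<p , far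
      where
      far : ∀ n → α n ≢ γ n → 1 /1+ n ℚ.< _
      far n α≢γ with α n ≟ β n
      ... | no α≢β  = <⇒<+ˡ 0<q (h n α≢β)
      ... | yes α≡β = <⇒<+ʳ 0<p (h′ n (α≢γ ∘ trans α≡β))

    maxUpTo : (ℕ → ℕ) → ℕ → ℕ
    maxUpTo f zero    = 0
    maxUpTo f (suc n) = maxUpTo f n ⊔ f n

    ≤-maxUpTo : ∀ f {i n} → i < n → f i ≤ maxUpTo f n
    ≤-maxUpTo f {i} {suc n} i<1+n with ℕ.m≤n⇒m<n∨m≡n (ℕ.≤-pred i<1+n)
    ... | inj₁ i<n  = ℕ.≤-trans (≤-maxUpTo f i<n) (ℕ.m≤m⊔n _ (f n))
    ... | inj₂ refl = ℕ.m≤n⊔m (maxUpTo f n) (f n)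

    lim : (x : ℕ → ℕ → Carrier) →
          (∀ ε → 0ℚᵘ ℚ.< ε → ∃[ N ] (∀ m n → N ≤ m → N ≤ n → Below (x m) (x n) ε)) →
          ∃[ y ] (∀ ε → 0ℚᵘ ℚ.< ε → ∃[ N ] (∀ n → N ≤ n → Below (x n) y ε))
    lim x cauchy = y , conv
      where
      stage : ℕ → ℕ
      stage n = proj₁ (cauchy (1 /1+ n) (0<1/1+ n))

      y : ℕ → Carrier
      y n = x (stage n) n

      agree : ∀ n m → stage n ≤ m → x m n ≡ y n
      agree n m st≤m = decidable-stable (x m n ≟ y n) (λ ne → ℚ.<-irrefl ℚ.≃-refl
        (proj₂ (proj₂ (cauchy (1 /1+ n) (0<1/1+ n)) m (stage n) st≤m ℕ.≤-refl) n ne))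

      conv : ∀ ε → 0ℚᵘ ℚ.< ε → ∃[ N ] (∀ n → N ≤ n → Below (x n) y ε)
      conv ε 0<ε = let K , 1/K<ε = archimedean ε 0<ε in
        maxUpTo stage K , λ m M≤m → 0<ε , λ n ne → near 1/K<ε n (λ n<K →
          ne (agree n m (ℕ.≤-trans (≤-maxUpTo stage n<K) M≤m)))

    below : ∀ i j n → elt (i at n) ≢ elt (j at n) → n < i + j
    below i j n ne = ℕ.≰⇒> (λ i+j≤n → ne (cong elt (trans
      (at-≥ i n (ℕ.≤-trans (ℕ.m≤m+n i j) i+j≤n))
      (sym (at-≥ j n (ℕ.≤-trans (ℕ.m≤n+m j i) i+j≤n))))))

    -- The arguments are n , i , j , m , k, and i , j , m , k for bound.

    differ : RecursiveRel {5} (λ v → ¬ elt (lookup v 1F at lookup v 0F) ≡ elt (lookup v 2F at lookup v 0F))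
    differ = ¬ᴿ (≡ᶜ (comp₂ _at_ at-rec (proj 1F) (proj 0F)) (comp₂ _at_ at-rec (proj 2F) (proj 0F)))

    product : Recursive {5} (λ v → lookup v 3F * suc (lookup v 0F))
    product = comp₂ _*_ *-rec (proj 3F) (comp₁ suc succ (proj 0F))

    bound : Recursive {4} (λ v → lookup v 0F + lookup v 1F)
    bound = comp₂ _+_ +-rec (proj 0F) (proj 1F)

-- The spaces 2, ω, ω^ω and 2^ω.

𝟚 ω 𝒩 𝒞 : PolishSpace
𝟚 = discrete 2-coded
ω = discrete ℕ-coded
𝒩 = sequences ℕ-coded
𝒞 = sequences 2-coded

-- The product space, with the maximum metric.

infixr 5 _⊗_

_⊗_ : PolishSpace → PolishSpace → PolishSpace
X ⊗ Y = record
  { Point    = Point X × Point Y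
  ; d        = dist
  ; d-refl   = λ { (x , y) 0<q → X.d-refl x 0<q , Y.d-refl y 0<q }
  ; d-sym    = λ { (x , y) (x′ , y′) (h , h′) → X.d-sym x x′ h , Y.d-sym y y′ h′ }
  ; d-tri    = λ { (x , y) (x′ , y′) (x″ , y″) (h , h′) (g , g′) → X.d-tri x x′ x″ h g , Y.d-tri y y′ y″ h′ g′ }
  ; complete = λ z cauchy →
      let x , cx = X.complete (proj₁ ∘ z) (λ ε 0<ε → let N , h = cauchy ε 0<ε in
                     N , λ m n N≤m N≤n → proj₁ (h m n N≤m N≤n))
          y , cy = Y.complete (proj₂ ∘ z) (λ ε 0<ε → let N , h = cauchy ε 0<ε in
                     N , λ m n N≤m N≤n → proj₂ (h m n N≤m N≤n))
      in (x , y) , λ ε 0<ε →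
      let M , h  = cx ε 0<ε
          N , h′ = cy ε 0<ε
      in M ⊔ N , λ n M⊔N≤n → h n (ℕ.≤-trans (ℕ.m≤m⊔n M N) M⊔N≤n) , h′ n (ℕ.≤-trans (ℕ.m≤n⊔m M N) M⊔N≤n)
  ; pt       = λ s → X.pt (s at 0) , Y.pt (s at 1)
  ; dense    = λ { (x , y) ε 0<ε →
      let i , h  = X.dense x ε 0<ε
          j , h′ = Y.dense y ε 0<ε
          c      = λ { zero → i ; (suc _) → j }
      in encode 2 c ,
         subst (λ s → X.d x (X.pt s) <ʳ ε) (sym (at-encode 2 c 0 (s≤s z≤n))) h ,
         subst (λ s → Y.d y (Y.pt s) <ʳ ε) (sym (at-encode 2 c 1 (s≤s (s≤s z≤n)))) h′ }
  ; <-rec    = ⇔ᴿ (λ { (_ ∷ _ ∷ _ ∷ _ ∷ []) → mk⇔ id id })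
      (∧ᴿ (substᴿ {g = args 0} X.<-rec (args-rec 0)) (substᴿ {g = args 1} Y.<-rec (args-rec 1)))
  ; ≤-rec    = ⇔ᴿ (λ { (_ ∷ _ ∷ _ ∷ _ ∷ []) → mk⇔
        (λ h p q<p → proj₁ h p q<p , proj₂ h p q<p)
        (λ h → (λ p q<p → proj₁ (h p q<p)) , (λ p q<p → proj₂ (h p q<p))) })
      (∧ᴿ (substᴿ {g = args 0} X.≤-rec (args-rec 0)) (substᴿ {g = args 1} Y.≤-rec (args-rec 1)))
  }
  where
  module X = PolishSpace X
  module Y = PolishSpace Y

  dist : Point X × Point Y → Point X × Point Y → ℝ≥0
  dist (x , y) (x′ , y′) = record
    { _<ʳ_      = λ q → X.d x x′ <ʳ q × Y.d y y′ <ʳ q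
    ; positive  = DX.positive ∘ proj₁
    ; inhabited = let p , h = DX.inhabited ; q , h′ = DY.inhabited in
        p ℚ.⊔ q , DX.upward h (ℚ.p≤p⊔q p q) , DY.upward h′ (ℚ.p≤q⊔p p q)
    ; upward    = λ h p≤q → DX.upward (proj₁ h) p≤q , DY.upward (proj₂ h) p≤q
    ; rounded   = λ h →
        let p , p<r , g  = DX.rounded (proj₁ h)
            q , q<r , g′ = DY.rounded (proj₂ h)
        in p ℚ.⊔ q , ⊔-< p<r q<r , DX.upward g (ℚ.p≤p⊔q p q) , DY.upward g′ (ℚ.p≤q⊔p p q)
    }
    where
    module DX = ℝ≥0 (X.d x x′)
    module DY = ℝ≥0 (Y.d y y′)

  args : ℕ → Fin 4 → Vec ℕ 4 → ℕ
  args c 0F v = lookup v 0F at c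
  args c 1F v = lookup v 1F at c
  args c 2F v = lookup v 2F
  args c 3F v = lookup v 3F

  args-rec : ∀ c i → Recursive (args c i)
  args-rec c 0F = comp₂ _at_ at-rec (proj 0F) (const c)
  args-rec c 1F = comp₂ _at_ at-rec (proj 1F) (const c)
  args-rec c 2F = proj 2F
  args-rec c 3F = proj 3F

data Type≤1 : PolishSpace → Set₁ where
  ω-type : Type≤1 ω
  𝒩-type : Type≤1 𝒩
  𝒞-type : Type≤1 𝒞
  ⊗-type : ∀ {X Y} → Type≤1 X → Type≤1 Y → Type≤1 (X ⊗ Y)

------------------------------------------------------------------------
-- Effectively open sets, recursive maps and good parametrizations

-- N(X,s) is the open ball with centre pt (s)₀ and radius (s)₁/((s)₂+1); it
-- is empty if (s)₁ = 0.

N : (X : PolishSpace) → ℕ → Pred (Point X) 0ℓ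
N X s x = d x (pt (s at 0)) <ʳ (s at 1) /1+ (s at 2)
  where open PolishSpace X

Open : (X : PolishSpace) → Pred (Pred (Point X) 0ℓ) 0ℓ
Open X P = ∀ x → x ∈ P → ∃[ ε ] (0ℚᵘ ℚ.< ε × (∀ y → d x y <ʳ ε → y ∈ P))
  where open PolishSpace X

Σ⁰₁ : (X : PolishSpace) → Pred (Pred (Point X) 0ℓ) 0ℓ
Σ⁰₁ X P = Σ[ ε ∈ (ℕ → ℕ) ] Recursive₁ ε × P ≐ (⋃[ i ∶ ℕ ] N X (ε i))

RecursiveMap : (X Y : PolishSpace) → (Point X → Point Y) → Set
RecursiveMap X Y f = Σ⁰₁ (X ⊗ ω) (λ { (x , k) → f x ∈ N Y k })

record GoodParametrization : Set₁ where
  field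
    G : (X : PolishSpace) → Pred (Point (𝒩 ⊗ X)) 0ℓ

  section : (X : PolishSpace) → Point 𝒩 → Pred (Point X) 0ℓ
  section X γ x = (γ , x) ∈ G X

  field
    G-Σ⁰₁    : ∀ X → Σ⁰₁ (𝒩 ⊗ X) (G X)
    open-iff : ∀ X (P : Pred (Point X) 0ℓ) →
               Open X P ⇔ (∃[ γ ] P ≐ section X γ)
    Σ⁰₁-iff  : ∀ X (P : Pred (Point X) 0ℓ) →
               Σ⁰₁ X P ⇔ (∃[ γ ] (Recursive₁ γ × P ≐ section X γ))
    s-m-n    : ∀ X Y → Type≤1 X →
               Σ[ S ∈ (Point (𝒩 ⊗ X) → Point 𝒩) ] RecursiveMap (𝒩 ⊗ X) 𝒩 S ×
               (∀ γ x y → ((γ , x , y) ∈ G (X ⊗ Y)) ⇔ ((S (γ , x) , y) ∈ G Y))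

------------------------------------------------------------------------
-- Countable ordinals

-- sup⁺ α is the least ordinal strictly above all α n, so every ordinal < ω₁
-- is denoted, in general in many ways; _≤ₒ_ and _<ₒ_ compare the denoted
-- ordinals, and two notations are identified by _≈ₒ_ if they denote the same
-- ordinal.

data Ord : Set where
  0ₒ   : Ord
  sup⁺ : (ℕ → Ord) → Ord

infix 4 _≤ₒ_ _<ₒ_ _≈ₒ_

mutual
  _≤ₒ_ : Ord → Ord → Set
  0ₒ     ≤ₒ β = ⊤
  sup⁺ α ≤ₒ β = ∀ n → α n <ₒ β

  _<ₒ_ : Ord → Ord → Set
  α <ₒ 0ₒ     = ⊥
  α <ₒ sup⁺ β = ∃[ n ] α ≤ₒ β n

_≈ₒ_ : Ord → Ord → Set
α ≈ₒ β = α ≤ₒ β × β ≤ₒ α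

1ₒ 2ₒ : Ord
1ₒ = sup⁺ (λ _ → 0ₒ)
2ₒ = sup⁺ (λ _ → 1ₒ)

------------------------------------------------------------------------
-- Borel codes

-- column γ i is (γ)ᵢ.

column : Point 𝒩 → ℕ → Point 𝒩
column γ i j = γ (2 ^ i * (2 * j + 1) ∸ 1)

shift : Point 𝒩 → Point 𝒩
shift γ i = γ (suc i)

module _ (𝒢 : GoodParametrization) where
  open GoodParametrization 𝒢

  -- {γ}^{X,Y}(x) is defined and equal to y.  Such a y is unique as a point,
  -- since the sets N(Y,k) separate points at positive distance.

  Value : (X Y : PolishSpace) → Point 𝒩 → Point X → Point Y → Set
  Value X Y γ x y = ∀ k → (y ∈ N Y k) ⇔ ((γ , x , k) ∈ G (X ⊗ ω))

  -- BC ξ is BC_ξ for ξ ≥ 1, and empty for ξ = 0.  In limit, δ i is the value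
  -- {γ*}(i), and it belongs to BC_(η i).

  data BC : Ord → Pred (Point 𝒩) 0ℓ where
    base  : ∀ {ξ γ} → ξ ≈ₒ 1ₒ → γ 0 ≡ 0 → BC ξ γ
    limit : ∀ {ξ γ} → 2ₒ ≤ₒ ξ → γ 0 ≡ 1 →
            (δ : ℕ → Point 𝒩) → (∀ i → Value ω 𝒩 (shift γ) i (δ i)) →
            (η : ℕ → Ord) → (∀ i → 1ₒ ≤ₒ η i × η i <ₒ ξ) → (∀ i → δ i ∈ BC (η i)) →
            BC ξ γ

  -- Membership in BC, the union of the BC_ξ for ξ ≥ 1.

  BorelCode : Pred (Point 𝒩) 0ℓ
  BorelCode γ = ∃[ ξ ] (1ₒ ≤ₒ ξ × γ ∈ BC ξ)

  -- ρ X c is ρ^X(γ), where c is any proof of γ ∈ BC; the set does not depend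
  -- on c, because γ 0 decides between the clauses and values are unique.

  ρ-BC : (X : PolishSpace) → ∀ {ξ γ} → γ ∈ BC ξ → Pred (Point X) 0ℓ
  ρ-BC X (base {γ = γ} _ _)    = ⋃[ i ∶ ℕ ] N X (shift γ i)
  ρ-BC X (limit _ _ _ _ _ _ c) = ⋃[ i ∶ ℕ ] ∁ (ρ-BC X (c i))

  ρ : (X : PolishSpace) → ∀ {γ} → γ ∈ BorelCode → Pred (Point X) 0ℓ
  ρ X (_ , _ , c) = ρ-BC X c

{-# OPTIONS --safe #-}
module Submission where

-- In limit form, the union of the sets ⋃ⱼ ∁ Aᵢⱼ (i ≤ n) is ⋃⟨ᵢ,ⱼ⟩ ∁ Aᵢⱼ, and
-- their intersection is the union, over all choices s of an index sᵢ for each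
-- i ≤ n, of the sets ∁ (⋃ᵢ Aᵢₛ₍ᵢ₎).  So the code of a union only rearranges the
-- codes of the Aᵢⱼ, and the code of an intersection enumerates codes of unions
-- of strictly smaller rank; no recursion theorem is needed.  An open code is
-- brought into limit form by writing a ball as a union of closed balls, and if
-- all codes are open, the intersection is enumerated by the balls strongly
-- inside one ball of each set.  Which case applies is decidable from the first
-- entries of the codes.  The s-m-n property yields the codes once the relations
-- involved are known to be Σ⁰₁, and this is checked with a normal form for
-- semirecursive predicates of numbers and one oracle.

open import Defs
open import Axiom.ExcludedMiddle using (ExcludedMiddle)
open import Data.Empty using (⊥-elim)
open import Data.Fin as Fin using (Fin; zero; suc; toℕ)
open import Data.Fin.Patterns using (0F; 1F; 2F; 3F; 4F; 5F)
import Data.Fin.Properties as Fin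
open import Data.Integer as ℤ using (+_)
import Data.Integer.Properties as ℤ
open import Data.Nat as ℕ using (ℕ; zero; suc; _+_; _*_; _∸_; _^_; _≤_; _<_; _⊔_; _⊓_; pred; z≤n; s≤s)
import Data.Nat.Properties as ℕ
open import Data.Product using (Σ-syntax; ∃-syntax; _×_; _,_; proj₁; proj₂)
open import Data.Rational.Unnormalised as ℚ using (ℚᵘ; mkℚᵘ; 0ℚᵘ; *<*)
import Data.Rational.Unnormalised.Properties as ℚ
open import Data.Sum using (_⊎_; inj₁; inj₂; [_,_]′)
open import Data.Unit using (tt)
open import Data.Vec using (Vec; []; _∷_; lookup; tabulate; tail)
open import Data.Vec.Properties using (tabulate∘lookup; lookup∘tabulate; tabulate-cong)
open import Function using (_∘_; id)
open import Function.Bundles using (_⇔_; mk⇔; module Equivalence)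
open import Level using (0ℓ)
open import Relation.Binary.PropositionalEquality using (_≡_; _≢_; _≗_; refl; sym; trans; cong; cong₂; subst; subst₂)
open import Relation.Nullary using (¬_; Dec; yes; no)
open import Relation.Nullary.Decidable using (¬?; decidable-stable)
open import Relation.Unary using (Pred; _∈_; _⊆_; _≐_; _∪_; ⋃; ⋂; ∁)

open Equivalence using (to; from)

-- The map must be total, although its argument need not consist of codes. So every relation handed
-- to the s-m-n property is defined for arbitrary oracles, and only for rows that are codes is it
-- shown to be the graph of the intended sequence. Both shapes of the result are forced: for ξ = 1
-- it has to be an open code, while for ξ ≥ 2 the set BC_ξ contains no open code, so (b) calls for
-- limit form as soon as one column has it. The unions inside an intersection are unions of rows of
-- an oracle that is not given but only described semirecursively by the original one; hence the
-- normal form has to be closed under substitution of oracles. Since pointwise equal sequences need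
-- not be equal, `BC` and `ρ` are shown to depend only on the values of a code. Excluded middle
-- enters through the linear order of the ordinals and through the recovery of an open set from
-- closed balls.

private
  variable
    k l m : ℕ

-- Substitution in recursive functions and relations

record RecursiveVec (g : Vec ℕ k → Vec ℕ l) : Set where
  constructor vec-rec
  field
    lookup-rec : ∀ i → Recursive (λ v → lookup (g v) i)

open RecursiveVec

∷-rec : {a : Vec ℕ k → ℕ} {g : Vec ℕ k → Vec ℕ l} →
        Recursive a → RecursiveVec g → RecursiveVec (λ v → a v ∷ g v)
∷-rec ra rg = vec-rec λ { zero → ra ; (suc i) → lookup-rec rg i }

[]-rec : RecursiveVec {k} (λ _ → [])
[]-rec = vec-rec λ ()

id-rec : RecursiveVec {k} id
id-rec = vec-rec proj

tail-rec : {g : Vec ℕ k → Vec ℕ (suc l)} → RecursiveVec g → RecursiveVec (tail ∘ g)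
tail-rec {l = l} {g} rg = vec-rec λ i → ext (λ v → lookup-tail (g v) i) (lookup-rec rg (suc i))
  where
  lookup-tail : (w : Vec ℕ (suc l)) → ∀ i → lookup w (suc i) ≡ lookup (tail w) i
  lookup-tail (_ ∷ _) i = refl

tail-rec₁ : RecursiveVec (tail {n = k})
tail-rec₁ = tail-rec id-rec

tail-rec₂ : RecursiveVec (tail {n = k} ∘ tail)
tail-rec₂ = tail-rec tail-rec₁

∘-rec : {f : Vec ℕ l → ℕ} {g : Vec ℕ k → Vec ℕ l} →
        Recursive f → RecursiveVec g → Recursive (f ∘ g)
∘-rec {f = f} {g} rf rg = ext (λ v → cong f (tabulate∘lookup (g v))) (comp rf (lookup-rec rg))

∘-vec : {h : Vec ℕ l → Vec ℕ m} {g : Vec ℕ k → Vec ℕ l} →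
        RecursiveVec h → RecursiveVec g → RecursiveVec (h ∘ g)
∘-vec rh rg = vec-rec λ i → ∘-rec (lookup-rec rh i) rg

∘ᴿ : {P : Pred (Vec ℕ l) 0ℓ} {g : Vec ℕ k → Vec ℕ l} →
     RecursiveRel P → RecursiveVec g → RecursiveRel (P ∘ g)
∘ᴿ {g = g} (χ , r , s) rg = χ ∘ g , ∘-rec r rg , λ v → s (g v)

suc-rec : {a : Vec ℕ k → ℕ} → Recursive a → Recursive (suc ∘ a)
suc-rec = comp₁ suc succ

_at-rec′_ : {a b : Vec ℕ k → ℕ} → Recursive a → Recursive b → Recursive (λ v → a v at b v)
_at-rec′_ = comp₂ _at_ at-rec

_*-rec′_ : {a b : Vec ℕ k → ℕ} → Recursive a → Recursive b → Recursive (λ v → a v * b v)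
_*-rec′_ = comp₂ _*_ *-rec

⟨⟩-rec : {a b : Vec ℕ k → ℕ} → Recursive a → Recursive b → Recursive (λ v → ⟨ a v , b v ⟩)
⟨⟩-rec ra rb = comp₂ _+_ +-rec (comp₁ tri tri-rec (comp₂ _+_ +-rec ra rb)) rb

-- Semirecursive predicates of numbers and one oracle

-- t codes a finite condition on the oracle: its values at 0 , … , (t)₀ are
-- the components of (t)₁.

infix 4 _⊏_

record _⊏_ (α : ℕ → ℕ) (t : ℕ) : Set where
  constructor meets
  field
    agrees : ∀ i → i < suc (t at 0) → α i ≡ (t at 1) at i

open _⊏_

-- The components of `t` from 2 on are free, so that one number serves both as condition on the
-- oracle and as carrier of the existential witnesses.
record SemiRecursive {k} (P : Vec ℕ k → (ℕ → ℕ) → Set) : Set₁ where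
  field
    Accept     : Pred (Vec ℕ (suc k)) 0ℓ
    accept-rec : RecursiveRel Accept
    sound      : ∀ {v α} t → Accept (t ∷ v) → α ⊏ t → P v α
    complete   : ∀ {v α} → P v α → ∃[ t ] (Accept (t ∷ v) × α ⊏ t)

open SemiRecursive

entries : ℕ → (ℕ → ℕ) → ℕ → ℕ → ℕ → ℕ
entries L α x y 0 = L
entries L α x y 1 = encode (suc L) α
entries L α x y 2 = x
entries L α x y _ = y

condition : ℕ → (ℕ → ℕ) → ℕ → ℕ → ℕ
condition L α x y = encode 4 (entries L α x y)

module _ (L : ℕ) (α : ℕ → ℕ) (x y : ℕ) where

  private
    component : ∀ i → i < 4 → condition L α x y at i ≡ entries L α x y i
    component = at-encode 4 (entries L α x y)

  condition-length : condition L α x y at 0 ≡ L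
  condition-length = component 0 (s≤s z≤n)

  condition-prefix : condition L α x y at 1 ≡ encode (suc L) α
  condition-prefix = component 1 (s≤s (s≤s z≤n))

  condition-2 : condition L α x y at 2 ≡ x
  condition-2 = component 2 (s≤s (s≤s (s≤s z≤n)))

  condition-3 : condition L α x y at 3 ≡ y
  condition-3 = component 3 (s≤s (s≤s (s≤s (s≤s z≤n))))

  condition-at : ∀ i → i ≤ L → (condition L α x y at 1) at i ≡ α i
  condition-at i i≤L = trans (cong (_at i) condition-prefix) (at-encode (suc L) α i (s≤s i≤L))

  ⊏-condition : α ⊏ condition L α x y
  ⊏-condition = meets λ i i<1+L′ → sym (condition-at i (subst (i ≤_) condition-length (ℕ.≤-pred i<1+L′)))

-- `Accept` cannot mention the oracle. This decidable relation between codes lets an accepted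
-- compound code guarantee that the oracle meets the codes embedded in it.
record Extends (t t′ : ℕ) : Set where
  constructor extends
  field
    longer : t′ at 0 ≤ t at 0
    same   : ∀ i → i < suc (t′ at 0) → (t at 1) at i ≡ (t′ at 1) at i

extendsᴿ : {a b : Vec ℕ k → ℕ} → Recursive a → Recursive b → RecursiveRel (λ v → Extends (a v) (b v))
extendsᴿ ra rb = ⇔ᴿ (λ _ → mk⇔ (λ { (h , e) → extends h e }) (λ { (extends h e) → h , e })) (∧ᴿ
  (≤ᴿ (rb at-rec′ const 0) (ra at-rec′ const 0))
  (∀<ᴿ (≡ᴿ ((∘-rec ra tail-rec₁ at-rec′ const 1) at-rec′ proj 0F) ((∘-rec rb tail-rec₁ at-rec′ const 1) at-rec′ proj 0F))
       (suc-rec (rb at-rec′ const 0))))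

⊏-extends : ∀ {α t t′} → Extends t t′ → α ⊏ t → α ⊏ t′
⊏-extends (extends L′≤L same) α⊏t = meets λ i i<L′ → trans (agrees α⊏t i (ℕ.≤-trans i<L′ (s≤s L′≤L))) (same i i<L′)

extends-condition : ∀ L α x y {t} → α ⊏ t → t at 0 ≤ L → Extends (condition L α x y) t
extends-condition L α x y {t} α⊏t L′≤L = extends (subst (t at 0 ≤_) (sym (condition-length L α x y)) L′≤L)
  λ i i<L′ → trans (condition-at L α x y i (ℕ.≤-trans (ℕ.≤-pred i<L′) L′≤L)) (agrees α⊏t i i<L′)

finite-choice : {Q : ℕ → ℕ → Set} → ∀ b → (∀ i → i < b → ∃[ t ] Q i t) → ∃[ T ] (∀ i → i < b → Q i (T i))
finite-choice {Q} b h = T , T-spec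
  where
  T : ℕ → ℕ
  T i with i ℕ.<? b
  ... | yes i<b = proj₁ (h i i<b)
  ... | no _    = 0

  T-spec : ∀ i → i < b → Q i (T i)
  T-spec i i<b with i ℕ.<? b
  ... | yes i<b′ = proj₂ (h i i<b′)
  ... | no i≮b   = ⊥-elim (i≮b i<b)

finite-bound : (f : ℕ → ℕ) → ∀ b → ∃[ L ] (∀ i → i < b → f i ≤ L)
finite-bound f zero    = 0 , λ _ ()
finite-bound f (suc b) = let L , h = finite-bound f b in L ⊔ f b , λ i i<1+b → bound L h i (ℕ.m≤n⇒m<n∨m≡n (ℕ.≤-pred i<1+b))
  where
  bound : ∀ L → (∀ i → i < b → f i ≤ L) → ∀ i → i < b ⊎ i ≡ b → f i ≤ L ⊔ f b
  bound L h i (inj₁ i<b)  = ℕ.≤-trans (h i i<b) (ℕ.m≤m⊔n L (f b))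
  bound L h i (inj₂ refl) = ℕ.m≤n⊔m L (f b)

⇔ˢ : {P Q : Vec ℕ k → (ℕ → ℕ) → Set} → (∀ v α → P v α ⇔ Q v α) → SemiRecursive P → SemiRecursive Q
⇔ˢ P⇔Q p = record
  { accept-rec = accept-rec p
  ; sound      = λ t a α⊏t → to (P⇔Q _ _) (sound p t a α⊏t)
  ; complete   = λ q → complete p (from (P⇔Q _ _) q)
  }

∘ˢ : {P : Vec ℕ l → (ℕ → ℕ) → Set} {g : Vec ℕ k → Vec ℕ l} →
     SemiRecursive P → RecursiveVec g → SemiRecursive (P ∘ g)
∘ˢ p rg = record
  { accept-rec = ∘ᴿ (accept-rec p) (∷-rec (proj 0F) (∘-vec rg tail-rec₁))
  ; sound      = sound p
  ; complete   = complete p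
  }

recˢ : {R : Pred (Vec ℕ k) 0ℓ} → RecursiveRel R → SemiRecursive (λ v _ → R v)
recˢ r = record
  { accept-rec = ∘ᴿ r tail-rec₁
  ; sound      = λ _ a _ → a
  ; complete   = λ {_} {α} a → condition 0 α 0 0 , a , ⊏-condition 0 α 0 0
  }

queryˢ : {a b : Vec ℕ k → ℕ} → Recursive a → Recursive b → SemiRecursive (λ v α → α (a v) ≡ b v)
queryˢ {a = a} {b} ra rb = record
  { Accept     = λ w → a (tail w) ≤ lookup w 0F at 0 × (lookup w 0F at 1) at a (tail w) ≡ b (tail w)
  ; accept-rec = ∧ᴿ (≤ᴿ (∘-rec ra tail-rec₁) (proj 0F at-rec′ const 0))
      (≡ᴿ ((proj 0F at-rec′ const 1) at-rec′ ∘-rec ra tail-rec₁) (∘-rec rb tail-rec₁))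
  ; sound      = λ { t (a≤L , e) α⊏t → trans (agrees α⊏t _ (s≤s a≤L)) e }
  ; complete   = λ {v} {α} e → condition (a v) α 0 0 ,
      (ℕ.≤-reflexive (sym (condition-length (a v) α 0 0)) , trans (condition-at (a v) α 0 0 (a v) ℕ.≤-refl) e) ,
      ⊏-condition (a v) α 0 0
  }

∃ˢ : {P : Vec ℕ (suc k) → (ℕ → ℕ) → Set} → SemiRecursive P → SemiRecursive (λ v α → ∃[ x ] P (x ∷ v) α)
∃ˢ p = record
  { Accept     = λ w → Accept p (lookup w 0F at 2 ∷ lookup w 0F at 3 ∷ tail w) × Extends (lookup w 0F) (lookup w 0F at 2)
  ; accept-rec = ∧ᴿ
      (∘ᴿ (accept-rec p) (∷-rec (proj 0F at-rec′ const 2) (∷-rec (proj 0F at-rec′ const 3) tail-rec₁)))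
      (extendsᴿ (proj 0F) (proj 0F at-rec′ const 2))
  ; sound      = λ { t (a , e) α⊏t → t at 3 , sound p _ a (⊏-extends e α⊏t) }
  ; complete   = λ { {v} {α} (x , h) → let t , a , α⊏t = complete p h ; L = t at 0 in
      condition L α t x ,
      (subst₂ (λ t′ x′ → Accept p (t′ ∷ x′ ∷ v)) (sym (condition-2 L α t x)) (sym (condition-3 L α t x)) a ,
       subst (Extends (condition L α t x)) (sym (condition-2 L α t x)) (extends-condition L α t x α⊏t ℕ.≤-refl)) ,
      ⊏-condition L α t x }
  }

-- Finitely many witnesses fit into one sequence, and the conditions they impose are all prefixes of
-- the same oracle, so one prefix of maximal length covers them.
∀<ˢ : {P : Vec ℕ (suc k) → (ℕ → ℕ) → Set} {b : Vec ℕ k → ℕ} → SemiRecursive P → Recursive b →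
      SemiRecursive (λ v α → ∀ i → i < b v → P (i ∷ v) α)
∀<ˢ {k} {P} {b} p rb = record
  { Accept     = λ w → ∀ i → i < b (tail w) →
      Accept p (code w i ∷ i ∷ tail w) × Extends (lookup w 0F) (code w i)
  ; accept-rec = ∀<ᴿ (∧ᴿ (∘ᴿ (accept-rec p) (∷-rec code-rec (∷-rec (proj 0F) tail-rec₂))) (extendsᴿ (proj 1F) code-rec))
      (∘-rec rb tail-rec₁)
  ; sound      = λ t h α⊏t i i<b → let a , e = h i i<b in sound p _ a (⊏-extends e α⊏t)
  ; complete   = λ {v} {α} h → complete′ v α h
  }
  where
  code : Vec ℕ (suc k) → ℕ → ℕ
  code w i = (lookup w 0F at 2) at i

  code-rec : Recursive {suc (suc k)} (λ w → (lookup w 1F at 2) at lookup w 0F)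
  code-rec = (proj 1F at-rec′ const 2) at-rec′ proj 0F

  complete′ : ∀ v α → (∀ i → i < b v → P (i ∷ v) α) →
    ∃[ t ] ((∀ i → i < b v → Accept p ((t at 2) at i ∷ i ∷ v) × Extends t ((t at 2) at i)) × α ⊏ t)
  complete′ v α h with finite-choice (b v) (λ i i<b → complete p (h i i<b))
  ... | T , T-spec with finite-bound (λ i → T i at 0) (b v)
  ... | L , T≤L = condition L α c 0 , spec , ⊏-condition L α c 0
    where
    c : ℕ
    c = encode (b v) T

    spec : ∀ i → i < b v → Accept p ((condition L α c 0 at 2) at i ∷ i ∷ v) ×
                           Extends (condition L α c 0) ((condition L α c 0 at 2) at i)
    spec i i<b rewrite condition-2 L α c 0 | at-encode (b v) T i i<b =
      proj₁ (T-spec i i<b) , extends-condition L α c 0 (proj₂ (T-spec i i<b)) (T≤L i i<b)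

→ˢ : {R : Pred (Vec ℕ k) 0ℓ} {P : Vec ℕ k → (ℕ → ℕ) → Set} →
     RecursiveRel R → SemiRecursive P → SemiRecursive (λ v α → R v → P v α)
→ˢ {R = R} {P} r p = record
  { accept-rec = →ᴿ (∘ᴿ r tail-rec₁) (accept-rec p)
  ; sound      = λ t h α⊏t a → sound p t (h a) α⊏t
  ; complete   = λ {v} {α} h → complete′ v α h (RecursiveRel⇒Dec r v)
  }
  where
  complete′ : ∀ v α → (R v → P v α) → Dec (R v) → ∃[ t ] ((R v → Accept p (t ∷ v)) × α ⊏ t)
  complete′ v α h (yes a) = let t , b , α⊏t = complete p (h a) in t , (λ _ → b) , α⊏t
  complete′ v α h (no ¬a) = condition 0 α 0 0 , (λ a → ⊥-elim (¬a a)) , ⊏-condition 0 α 0 0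

∧ˢ : {P Q : Vec ℕ k → (ℕ → ℕ) → Set} → SemiRecursive P → SemiRecursive Q → SemiRecursive (λ v α → P v α × Q v α)
∧ˢ p q = record
  { Accept     = λ w → (Accept p (lookup w 0F at 2 ∷ tail w) × Accept q (lookup w 0F at 3 ∷ tail w)) ×
                       (Extends (lookup w 0F) (lookup w 0F at 2) × Extends (lookup w 0F) (lookup w 0F at 3))
  ; accept-rec = ∧ᴿ
      (∧ᴿ (∘ᴿ (accept-rec p) (∷-rec (proj 0F at-rec′ const 2) tail-rec₁))
          (∘ᴿ (accept-rec q) (∷-rec (proj 0F at-rec′ const 3) tail-rec₁)))
      (∧ᴿ (extendsᴿ (proj 0F) (proj 0F at-rec′ const 2)) (extendsᴿ (proj 0F) (proj 0F at-rec′ const 3)))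
  ; sound      = λ { t ((a , b) , e , f) α⊏t → sound p _ a (⊏-extends e α⊏t) , sound q _ b (⊏-extends f α⊏t) }
  ; complete   = λ { {v} {α} (x , y) →
      let s , a , α⊏s = complete p x
          t , b , α⊏t = complete q y
          L           = s at 0 ⊔ t at 0
      in condition L α s t ,
         ((subst (λ s′ → Accept p (s′ ∷ v)) (sym (condition-2 L α s t)) a ,
           subst (λ t′ → Accept q (t′ ∷ v)) (sym (condition-3 L α s t)) b) ,
          subst (Extends (condition L α s t)) (sym (condition-2 L α s t))
            (extends-condition L α s t α⊏s (ℕ.m≤m⊔n (s at 0) (t at 0))) ,
          subst (Extends (condition L α s t)) (sym (condition-3 L α s t))
            (extends-condition L α s t α⊏t (ℕ.m≤n⊔m (s at 0) (t at 0)))) ,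
         ⊏-condition L α s t }
  }

∨ˢ : {P Q : Vec ℕ k → (ℕ → ℕ) → Set} → SemiRecursive P → SemiRecursive Q → SemiRecursive (λ v α → P v α ⊎ Q v α)
∨ˢ {k} {P} {Q} p q = ⇔ˢ (λ v α → mk⇔ left right)
  (∃ˢ (∧ˢ (→ˢ zero? (∘ˢ p tail-rec₁)) (→ˢ (¬ᴿ zero?) (∘ˢ q tail-rec₁))))
  where
  zero? : RecursiveRel {suc k} (λ w → lookup w 0F ≡ 0)
  zero? = ≡ᴿ (proj 0F) (const 0)

  left : {A B : Set} → ∃[ x ] ((x ≡ 0 → A) × (x ≢ 0 → B)) → A ⊎ B
  left (zero  , a , _) = inj₁ (a refl)
  left (suc _ , _ , b) = inj₂ (b λ ())

  right : {A B : Set} → A ⊎ B → ∃[ x ] ((x ≡ 0 → A) × (x ≢ 0 → B))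
  right (inj₁ a) = 0 , (λ _ → a) , λ 0≢0 → ⊥-elim (0≢0 refl)
  right (inj₂ b) = 1 , (λ ()) , λ _ → b

-- Γ (i ∷ y ∷ v) says that the substituted oracle takes the value y at i.

module _ {P : Vec ℕ k → (ℕ → ℕ) → Set} {Γ : Vec ℕ (suc (suc k)) → (ℕ → ℕ) → Set} where

  -- Acceptance uses finitely many values of the substituted oracle, and `Γ` certifies each of them.
  -- The formula is meaningful for every `β`, also where `Γ` is not the graph of a function.
  Substituted : SemiRecursive P → Vec ℕ k → (ℕ → ℕ) → Set
  Substituted p v β = ∃[ t ] (Accept p (t ∷ v) × (∀ i → i < suc (t at 0) → Γ (i ∷ (t at 1) at i ∷ v) β))

  substˢ : (p : SemiRecursive P) → SemiRecursive Γ → SemiRecursive (Substituted p)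
  substˢ p γ = ∃ˢ (∧ˢ (recˢ (accept-rec p))
    (∀<ˢ (∘ˢ γ (∷-rec (proj 0F) (∷-rec ((proj 1F at-rec′ const 1) at-rec′ proj 0F) tail-rec₂)))
         (suc-rec (proj 0F at-rec′ const 0))))

  substituted : (p : SemiRecursive P) → ∀ {v β α} → (∀ i y → Γ (i ∷ y ∷ v) β ⇔ (α i ≡ y)) →
                Substituted p v β ⇔ P v α
  substituted p Γ⇔α = mk⇔
    (λ { (t , a , h) → sound p t a (meets λ i i<L → to (Γ⇔α _ _) (h i i<L)) })
    (λ h → let t , a , α⊏t = complete p h in t , a , λ i i<L → from (Γ⇔α _ _) (agrees α⊏t i i<L))

-- Membership in balls, and computable maps

Graph : (f : Vec ℕ k → (ℕ → ℕ) → ℕ → ℕ) → Set₁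
Graph f = SemiRecursive (λ w α → f (tail (tail w)) α (lookup w 0F) ≡ lookup w 1F)

value : {f : Vec ℕ k → (ℕ → ℕ) → ℕ → ℕ} {g : Vec ℕ l → Vec ℕ k} {a b : Vec ℕ l → ℕ} →
        Graph f → RecursiveVec g → Recursive a → Recursive b → SemiRecursive (λ v α → f (g v) α (a v) ≡ b v)
value f g a b = ∘ˢ f (∷-rec a (∷-rec b g))

-- Distance below m/(r+1) means agreement with the centre at every n with 1/(n+1) ≥ m/(r+1); as m ≥
-- 1, such n are at most r, which bounds the quantifier. The sequence is replaced by a relation `Γ`
-- that need not be a graph.
InBall : (ℕ → ℕ → Set) → ℕ → ℕ → ℕ → Set
InBall Γ c m r = 0 < m × (∀ n → n < suc r → m * suc n ≤ suc r → Γ n (c at n))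

inBall : ∀ {γ : ℕ → ℕ} {c m r} → PolishSpace.d 𝒩 γ (PolishSpace.pt 𝒩 c) <ʳ m /1+ r ⇔ InBall (λ n y → γ n ≡ y) c m r
inBall {γ} {c} {m} {r} = mk⇔ fwd bwd
  where
  fwd : PolishSpace.d 𝒩 γ (PolishSpace.pt 𝒩 c) <ʳ m /1+ r → InBall (λ n y → γ n ≡ y) c m r
  fwd (0<q , h) = subst (0 <_) (ℕ.*-identityʳ m) (/1+-<⁻ 0<q) , λ n _ le →
    decidable-stable (γ n ℕ.≟ c at n) λ ne →
      ℕ.<⇒≱ (subst (_< m * suc n) (ℕ.*-identityˡ (suc r)) (/1+-<⁻ (h n ne))) le

  bwd : InBall (λ n y → γ n ≡ y) c m r → PolishSpace.d 𝒩 γ (PolishSpace.pt 𝒩 c) <ʳ m /1+ r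
  bwd (0<m , h) = /1+-<⁺ (subst (0 <_) (sym (ℕ.*-identityʳ m)) 0<m) , λ n ne →
    /1+-<⁺ (subst (_< m * suc n) (sym (ℕ.*-identityˡ (suc r))) (ℕ.≰⇒> λ le →
      ne (h n (ℕ.≤-trans (ℕ.≤-trans (ℕ.m≤n*m (suc n) m ⦃ ℕ.>-nonZero 0<m ⦄) le) ℕ.≤-refl) le)))

InBall-cong : ∀ {Γ Δ : ℕ → ℕ → Set} {c m r} → (∀ n y → Γ n y ⇔ Δ n y) → InBall Γ c m r ⇔ InBall Δ c m r
InBall-cong e = mk⇔ (λ { (p , h) → p , λ n b g → to (e _ _) (h n b g) }) (λ { (p , h) → p , λ n b g → from (e _ _) (h n b g) })

inBallˢ : {Γ : Vec ℕ (suc (suc k)) → (ℕ → ℕ) → Set} {c m r : Vec ℕ k → ℕ} → SemiRecursive Γ →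
          Recursive c → Recursive m → Recursive r →
          SemiRecursive (λ v α → InBall (λ n y → Γ (n ∷ y ∷ v) α) (c v) (m v) (r v))
inBallˢ γ rc rm rr = ∧ˢ (recˢ (≤ᴿ (const 1) rm))
  (∀<ˢ (→ˢ (≤ᴿ (∘-rec rm tail-rec₁ *-rec′ suc-rec (proj 0F)) (suc-rec (∘-rec rr tail-rec₁)))
           (∘ˢ γ (∷-rec (proj 0F) (∷-rec (∘-rec rc tail-rec₁ at-rec′ proj 0F) tail-rec₁))))
       (suc-rec rr))

-- Centre and radius range over recursive functions of a possibly longer tuple, so that the balls
-- can themselves be quantified over.
record Computable (Z : PolishSpace) (z : Vec ℕ k → (ℕ → ℕ) → Point Z) : Set₁ where
  constructor computable
  field
    within : ∀ {l} {g : Vec ℕ l → Vec ℕ k} {c m r : Vec ℕ l → ℕ} → RecursiveVec g →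
      Recursive c → Recursive m → Recursive r →
      SemiRecursive (λ v α → PolishSpace.d Z (z (g v) α) (PolishSpace.pt Z (c v)) <ʳ m v /1+ r v)

open Computable

ω-computable : {a : Vec ℕ k → ℕ} → Recursive a → Computable ω (λ v _ → a v)
ω-computable ra = computable λ rg rc rm rr → recˢ (∘ᴿ (PolishSpace.<-rec ω)
  (∷-rec (∘-rec ra rg) (∷-rec rc (∷-rec rm (∷-rec rr []-rec)))))

𝒩-computable : {f : Vec ℕ k → (ℕ → ℕ) → ℕ → ℕ} → Graph f → Computable 𝒩 f
𝒩-computable {f = f} rf = computable λ rg rc rm rr → ⇔ˢ (λ v α → mk⇔ (from inBall) (to inBall))
  (inBallˢ (value {f = f} rf (∘-vec rg tail-rec₂) (proj 0F) (proj 1F)) rc rm rr)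

⊗-computable : ∀ X Y {x : Vec ℕ k → (ℕ → ℕ) → Point X} {y : Vec ℕ k → (ℕ → ℕ) → Point Y} →
               Computable X x → Computable Y y → Computable (X ⊗ Y) (λ v α → x v α , y v α)
⊗-computable X Y cx cy = computable λ rg rc rm rr → ∧ˢ (within cx rg (rc at-rec′ const 0) rm rr) (within cy rg (rc at-rec′ const 1) rm rr)

∘-computable : ∀ {Z} {z : Vec ℕ l → (ℕ → ℕ) → Point Z} {h : Vec ℕ k → Vec ℕ l} →
               Computable Z z → RecursiveVec h → Computable Z (z ∘ h)
∘-computable cz rh = computable λ rg → within cz (∘-vec rh rg)

Σ⁰₁ˢ : ∀ Z {Q : Pred (Point Z) 0ℓ} {z : Vec ℕ k → (ℕ → ℕ) → Point Z} →
       Σ⁰₁ Z Q → Computable Z z → SemiRecursive (λ v α → z v α ∈ Q)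
Σ⁰₁ˢ Z {z = z} (ε , rε , Q⊆ , ⊆Q) cz = ⇔ˢ (λ v α → mk⇔ ⊆Q Q⊆)
  (∃ˢ {P = λ w α → z (tail w) α ∈ N Z (ε (lookup w 0F))}
    (within cz tail-rec₁ (εt at-rec′ const 0) (εt at-rec′ const 1) (εt at-rec′ const 2)))
  where
  εt : Recursive {suc _} (λ w → ε (lookup w 0F))
  εt = comp₁ ε rε (proj 0F)

-- The value of δ at m is read off from the balls of radius 1/(m+1)
-- containing δ.

ReadOff : (ℕ → Set) → ℕ → ℕ → Set
ReadOff B m y = ∃[ s ] (B s × (s at 1 ≡ 1 × s at 2 ≡ m × (s at 0) at m ≡ y))

readOffˢ : {B : Vec ℕ (suc k) → (ℕ → ℕ) → Set} {m y : Vec ℕ k → ℕ} → SemiRecursive B →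
           Recursive m → Recursive y → SemiRecursive (λ v α → ReadOff (λ s → B (s ∷ v) α) (m v) (y v))
readOffˢ b rm ry = ∃ˢ (∧ˢ b (recˢ (∧ᴿ (≡ᴿ (proj 0F at-rec′ const 1) (const 1))
  (∧ᴿ (≡ᴿ (proj 0F at-rec′ const 2) (∘-rec rm tail-rec₁))
      (≡ᴿ ((proj 0F at-rec′ const 0) at-rec′ ∘-rec rm tail-rec₁) (∘-rec ry tail-rec₁))))))

ball-entries : ℕ → ℕ → ℕ → ℕ
ball-entries c r 0 = c
ball-entries c r 1 = 1
ball-entries c r _ = r

ball : ℕ → ℕ → ℕ
ball c r = encode 3 (ball-entries c r)

ball-centre : ∀ c r → ball c r at 0 ≡ c
ball-centre c r = at-encode 3 (ball-entries c r) 0 (s≤s z≤n)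

ball-num : ∀ c r → ball c r at 1 ≡ 1
ball-num c r = at-encode 3 (ball-entries c r) 1 (s≤s (s≤s z≤n))

ball-den : ∀ c r → ball c r at 2 ≡ r
ball-den c r = at-encode 3 (ball-entries c r) 2 (s≤s (s≤s (s≤s z≤n)))

N-ball : ∀ Z {z} c r → PolishSpace.d Z z (PolishSpace.pt Z c) <ʳ 1 /1+ r ⇔ (z ∈ N Z (ball c r))
N-ball Z c r rewrite ball-centre c r | ball-num c r | ball-den c r = mk⇔ id id

𝒩-ball : ∀ {γ : ℕ → ℕ} c r → PolishSpace.d 𝒩 γ (PolishSpace.pt 𝒩 c) <ʳ 1 /1+ r ⇔ (∀ i → i < suc r → γ i ≡ c at i)
𝒩-ball c r = mk⇔
  (λ h i i<1+r → proj₂ (to inBall h) i i<1+r (subst (_≤ suc r) (sym (ℕ.*-identityˡ (suc i))) i<1+r))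
  (λ h → from inBall (s≤s z≤n , λ i i<1+r _ → h i i<1+r))

readOff : ∀ {δ : ℕ → ℕ} {B : ℕ → Set} → (∀ s → (δ ∈ N 𝒩 s) ⇔ B s) → ∀ m y → ReadOff B m y ⇔ (δ m ≡ y)
readOff {δ} {B} e m y = mk⇔ fwd bwd
  where
  fwd : ReadOff B m y → δ m ≡ y
  fwd (s , b , e₁ , refl , ey) = trans
    (to (𝒩-ball (s at 0) (s at 2))
      (subst (λ q → PolishSpace.d 𝒩 δ (PolishSpace.pt 𝒩 (s at 0)) <ʳ q /1+ (s at 2)) e₁ (from (e s) b)) _ ℕ.≤-refl)
    ey

  bwd : δ m ≡ y → ReadOff B m y
  bwd refl = ball c m ,
    to (e _) (to (N-ball 𝒩 c m) (from (𝒩-ball c m) λ i i<1+m → sym (at-encode (suc m) δ i i<1+m))) ,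
    ball-num c m , ball-den c m , trans (cong (_at m) (ball-centre c m)) (at-encode (suc m) δ m ℕ.≤-refl)
    where
    c = encode (suc m) δ

image-graph : ∀ Z {f : Point Z → Point 𝒩} {z : Vec ℕ k → (ℕ → ℕ) → Point Z} → RecursiveMap Z 𝒩 f → Computable Z z →
              Graph (λ v α → f (z v α))
image-graph Z rf cz = ⇔ˢ (λ w α → readOff (λ _ → mk⇔ id id) _ _)
  (readOffˢ (∘ˢ (Σ⁰₁ˢ (Z ⊗ ω) rf (⊗-computable Z ω (∘-computable cz tail-rec₁) (ω-computable (proj 0F))))
                (∷-rec (proj 0F) (∘-vec tail-rec₂ tail-rec₁)))
            (proj 0F) (proj 1F))

-- A recursive enumeration of the balls with radius 1/(L+1) of a space whose
-- points are given by finitely many numbers and one sequence.  Not every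
-- tuple of numbers needs to be valid.

record Chart (Z : PolishSpace) (k : ℕ) : Set₁ where
  field
    numbers    : Point Z → Vec ℕ k
    oracle     : Point Z → ℕ → ℕ
    centre     : Vec ℕ (suc k) → ℕ
    centre-rec : Recursive centre
    Valid      : Pred (Vec ℕ k) 0ℓ
    valid-rec  : RecursiveRel Valid
    valid      : ∀ z → Valid (numbers z)
    near       : ∀ z c L → (∀ i → i < suc L → oracle z i ≡ c at i) →
                 PolishSpace.d Z z (PolishSpace.pt Z (centre (c ∷ numbers z))) <ʳ 1 /1+ L
    near⁻¹     : ∀ z c L v → Valid v → PolishSpace.d Z z (PolishSpace.pt Z (centre (c ∷ v))) <ʳ 1 /1+ L →
                 v ≡ numbers z × (∀ i → i < suc L → oracle z i ≡ c at i)

ball-rec : {a b : Vec ℕ k → ℕ} → Recursive a → Recursive b → Recursive (λ v → ball (a v) (b v))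
ball-rec ra rb = ⟨⟩-rec ra (⟨⟩-rec (const 1) (⟨⟩-rec rb (const 0)))

N-empty : ∀ Z {z} → ¬ z ∈ N Z 0
N-empty Z {z} h = ℕ.n≮n 0 (/1+-<⁻ (ℝ≥0.positive (PolishSpace.d Z z (PolishSpace.pt Z 0)) h))

filter : {R : Pred (Vec ℕ k) 0ℓ} → RecursiveRel R → (Vec ℕ k → ℕ) → Vec ℕ k → ℕ
filter (χ , _ , _) a v = χ v * a v

filter-rec : {R : Pred (Vec ℕ k) 0ℓ} {a : Vec ℕ k → ℕ} (r : RecursiveRel R) → Recursive a → Recursive (filter r a)
filter-rec (_ , rχ , _) ra = rχ *-rec′ ra

module _ {R : Pred (Vec ℕ k) 0ℓ} (r : RecursiveRel R) (a : Vec ℕ k → ℕ) {v : Vec ℕ k} where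

  filter-accept : R v → filter r a v ≡ a v
  filter-accept p with proj₂ (proj₂ r) v
  ... | inj₁ (_ , e)  = trans (cong (_* a v) e) (ℕ.*-identityˡ (a v))
  ... | inj₂ (¬p , _) = ⊥-elim (¬p p)

  filter-reject : ¬ R v → filter r a v ≡ 0
  filter-reject ¬p with proj₂ (proj₂ r) v
  ... | inj₁ (p , _) = ⊥-elim (¬p p)
  ... | inj₂ (_ , e) = cong (_* a v) e

N-filter : ∀ Z {R : Pred (Vec ℕ k) 0ℓ} (r : RecursiveRel R) (a : Vec ℕ k → ℕ) v {z} →
           (z ∈ N Z (filter r a v)) ⇔ (R v × z ∈ N Z (a v))
N-filter Z {R} r a v {z} = mk⇔ fwd bwd
  where
  fwd : z ∈ N Z (filter r a v) → R v × z ∈ N Z (a v)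
  fwd h with RecursiveRel⇒Dec r v
  ... | yes p = p , subst (λ s → z ∈ N Z s) (filter-accept r a p) h
  ... | no ¬p = ⊥-elim (N-empty Z (subst (λ s → z ∈ N Z s) (filter-reject r a ¬p) h))

  bwd : R v × z ∈ N Z (a v) → z ∈ N Z (filter r a v)
  bwd (p , h) = subst (λ s → z ∈ N Z s) (sym (filter-accept r a p)) h

Σ⁰₁-select : ∀ Z (Q : Pred (Point Z) 0ℓ) {R : Pred (Vec ℕ 1) 0ℓ} {b : Vec ℕ 1 → ℕ} → RecursiveRel R → Recursive b →
             (∀ z → z ∈ Q → ∃[ x ] (R (x ∷ []) × z ∈ N Z (b (x ∷ [])))) →
             (∀ z x → R (x ∷ []) → z ∈ N Z (b (x ∷ [])) → z ∈ Q) → Σ⁰₁ Z Q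
Σ⁰₁-select Z Q {b = b} r rb cover sub =
  (λ x → filter r b (x ∷ [])) , ∘-rec (filter-rec r rb) (∷-rec (proj 0F) []-rec) ,
  (λ q → let x , h = cover _ q in x , from (N-filter Z r b (x ∷ [])) h) ,
  (λ { (x , h) → let p , h′ = to (N-filter Z r b (x ∷ [])) h in sub _ x p h′ })

Realized : ∀ {Z} → Chart Z k → (Vec ℕ k → (ℕ → ℕ) → Set) → Pred (Point Z) 0ℓ
Realized chart P z = P (Chart.numbers chart z) (Chart.oracle chart z)

semiRecursive⇒Σ⁰₁ : ∀ Z {P : Vec ℕ k → (ℕ → ℕ) → Set} (chart : Chart Z k) → SemiRecursive P →
                    Σ⁰₁ Z (Realized chart P)
semiRecursive⇒Σ⁰₁ {k} Z {P} chart p = Σ⁰₁-select Z (Realized chart P)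
  (∧ᴿ (∘ᴿ valid-rec args-rec) (∘ᴿ (accept-rec p) (∷-rec (proj 0F at-rec′ const 0) args-rec)))
  (ball-rec (∘-rec centre-rec (∷-rec ((proj 0F at-rec′ const 0) at-rec′ const 1) args-rec)) ((proj 0F at-rec′ const 0) at-rec′ const 0))
  (λ z h → cover z (complete p h))
  (λ { z x (va , a) h →
    let e , agree = near⁻¹ z _ _ _ va (from (N-ball Z _ _) h)
    in sound p (x at 0) (subst (λ v → Accept p (x at 0 ∷ v)) e a) (meets agree) })
  where
  open Chart chart

  args : Vec ℕ 1 → Vec ℕ k
  args w = tabulate (λ i → lookup w 0F at suc (toℕ i))

  args-rec : RecursiveVec args
  args-rec = vec-rec λ i → ext (λ w → sym (lookup∘tabulate (λ i → lookup w 0F at suc (toℕ i)) i))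
    (proj 0F at-rec′ const (suc (toℕ i)))

  pack : ∀ {n} → ℕ → Vec ℕ n → ℕ → ℕ
  pack t v       zero    = t
  pack t []      (suc _) = 0
  pack t (x ∷ v) (suc i) = pack x v i

  pack-lookup : ∀ {n} t (v : Vec ℕ n) i → pack t v (suc (toℕ i)) ≡ lookup v i
  pack-lookup t (x ∷ v) zero    = refl
  pack-lookup t (x ∷ v) (suc i) = pack-lookup x v i

  args-pack : ∀ t v → args (encode (suc k) (pack t v) ∷ []) ≡ v
  args-pack t v = trans (tabulate-cong (λ i → trans (at-encode (suc k) (pack t v) (suc (toℕ i)) (s≤s (Fin.toℕ<n i))) (pack-lookup t v i)))
                        (tabulate∘lookup v)

  cover : ∀ z → ∃[ t ] (Accept p (t ∷ numbers z) × oracle z ⊏ t) →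
    ∃[ x ] ((Valid (args (x ∷ [])) × Accept p (x at 0 ∷ args (x ∷ []))) ×
            z ∈ N Z (ball (centre ((x at 0) at 1 ∷ args (x ∷ []))) ((x at 0) at 0)))
  cover z (t , a , α⊏t) = x , spec
    where
    x : ℕ
    x = encode (suc k) (pack t (numbers z))

    spec : (Valid (args (x ∷ [])) × Accept p (x at 0 ∷ args (x ∷ []))) ×
           z ∈ N Z (ball (centre ((x at 0) at 1 ∷ args (x ∷ []))) ((x at 0) at 0))
    spec rewrite args-pack t (numbers z) | at-encode (suc k) (pack t (numbers z)) 0 (s≤s z≤n) =
      (valid z , a) , to (N-ball Z _ _) (near z _ _ (agrees α⊏t))

-- Balls in Polish spaces

+-/1+ : ∀ m k m′ k′ → m /1+ k ℚ.+ m′ /1+ k′ ≡ (m * suc k′ + m′ * suc k) /1+ (k′ + k * suc k′)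
+-/1+ m k m′ k′ = cong (λ n → mkℚᵘ n (k′ + k * suc k′))
  (cong₂ ℤ._+_ (sym (ℤ.pos-* m (suc k′))) (sym (ℤ.pos-* m′ (suc k))))

positive-/1+ : ∀ {q} → 0ℚᵘ ℚ.< q → ∃[ m ] ∃[ k ] q ≡ m /1+ k
positive-/1+ {mkℚᵘ (+ m) k} _ = m , k , refl
positive-/1+ {mkℚᵘ (ℤ.-[1+ m ]) k} (*<* ())

gap : ∀ {p q} → p ℚ.< q → ∃[ n ] p ℚ.+ 1 /1+ n ℚ.< q
gap {p} {q} p<q =
  let n , 1/n<q-p = archimedean (q ℚ.- p) (ℚ.<-respˡ-≃ (ℚ.+-inverseʳ p) (ℚ.+-monoˡ-< (ℚ.- p) p<q))
  in n , ℚ.<-respʳ-≃ cancel (ℚ.+-monoʳ-< p 1/n<q-p)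
  where
  cancel : p ℚ.+ (q ℚ.- p) ℚ.≃ q
  cancel = ℚ.≃-trans (ℚ.+-comm p (q ℚ.- p)) (ℚ.≃-trans (ℚ.+-assoc q (ℚ.- p) p)
    (ℚ.≃-trans (ℚ.+-congʳ q (ℚ.+-inverseˡ p)) (ℚ.+-identityʳ q)))

gap₂ : ∀ {p q} → p ℚ.< q → ∃[ e ] (p ℚ.+ 1 /1+ e ℚ.+ 1 /1+ e ℚ.< q)
gap₂ {p} p<q =
  let m , h  = gap p<q
      n , h′ = gap h
  in m ⊔ n , ℚ.≤-<-trans
       (ℚ.+-mono-≤ (ℚ.+-monoʳ-≤ p (1/1+-anti (ℕ.m≤m⊔n m n))) (1/1+-anti (ℕ.m≤n⊔m m n))) h′

<-/1+ᴿ : {m n m′ n′ : Vec ℕ k → ℕ} → Recursive m → Recursive n → Recursive m′ → Recursive n′ →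
         RecursiveRel (λ v → m v /1+ n v ℚ.< m′ v /1+ n′ v)
<-/1+ᴿ rm rn rm′ rn′ = ⇔ᴿ (λ _ → mk⇔ /1+-<⁺ /1+-<⁻)
  (≤ᴿ (suc-rec (rm *-rec′ suc-rec rn′)) (rm′ *-rec′ suc-rec rn))

rational : ℕ → ℚᵘ
rational q = (q at 0) /1+ (q at 1)

rational-surjective : ∀ {q} → 0ℚᵘ ℚ.< q → ∃[ s ] rational s ≡ q
rational-surjective {q} 0<q = let m , k , e = positive-/1+ 0<q ; x = λ { 0 → m ; _ → k } in
  encode 2 x , trans (cong₂ _/1+_ (at-encode 2 x 0 (s≤s z≤n)) (at-encode 2 x 1 (s≤s (s≤s z≤n)))) (sym e)

module Balls (X : PolishSpace) where
  open PolishSpace X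

  centre : ℕ → Point X
  centre s = pt (s at 0)

  radius : ℕ → ℚᵘ
  radius s = (s at 1) /1+ (s at 2)

  abstract
    centre-distanceᴿ : {a b m n : Vec ℕ k → ℕ} → Recursive a → Recursive b → Recursive m → Recursive n →
      RecursiveRel (λ v → d (centre (a v)) (centre (b v)) <ʳ m v /1+ n v)
    centre-distanceᴿ ra rb rm rn = ∘ᴿ <-rec
      (∷-rec (ra at-rec′ const 0) (∷-rec (rb at-rec′ const 0) (∷-rec rm (∷-rec rn []-rec))))

  -- A decidable sufficient condition for inclusion of balls: `b` codes a rational bound on the
  -- distance of the centres that leaves room for the smaller radius.
  StronglyInside : ℕ → ℕ → ℕ → Set
  StronglyInside l b k = d (centre l) (centre k) <ʳ rational b × rational b ℚ.+ radius l ℚ.< radius k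

  abstract
    stronglyInsideᴿ : {a b c : Vec ℕ k → ℕ} → Recursive a → Recursive b → Recursive c →
      RecursiveRel (λ v → StronglyInside (a v) (b v) (c v))
    stronglyInsideᴿ {k} {a} {b} {c} ra rb rc = ∧ᴿ (centre-distanceᴿ ra rc (rb at-rec′ const 0) (rb at-rec′ const 1))
      (⇔ᴿ (λ v → mk⇔ (subst (ℚ._< radius (c v)) (sym (+-/1+ (b v at 0) (b v at 1) (a v at 1) (a v at 2))))
                     (subst (ℚ._< radius (c v)) (+-/1+ (b v at 0) (b v at 1) (a v at 1) (a v at 2))))
        (<-/1+ᴿ (comp₂ _+_ +-rec ((rb at-rec′ const 0) *-rec′ suc-rec (ra at-rec′ const 2))
                                 ((ra at-rec′ const 1) *-rec′ suc-rec (rb at-rec′ const 1)))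
                (comp₂ _+_ +-rec (ra at-rec′ const 2) ((rb at-rec′ const 1) *-rec′ suc-rec (ra at-rec′ const 2)))
                (rc at-rec′ const 1) (rc at-rec′ const 2)))

  inside⇒⊆ : ∀ l b k → StronglyInside l b k → N X l ⊆ N X k
  inside⇒⊆ l b k (h , lt) {x} x∈l = ℝ≥0.upward (d x (centre k)) (d-tri x _ _ x∈l h)
    (ℚ.<⇒≤ (ℚ.<-respˡ-≃ (ℚ.+-comm (rational b) (radius l)) lt))

  radius-ball : ∀ c r → radius (ball c r) ≡ 1 /1+ r
  radius-ball c r = cong₂ _/1+_ (ball-num c r) (ball-den c r)

  -- Take q strictly between the distance of `x` from the centre and the radius, and let twice
  -- 1/(E+1) fit between q and the radius. The distance of the centres is below `radius l` + q, and
  -- this sum serves as the bound. `E` is found before `l`, so that one small ball can later serve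
  -- several `k`.
  small-balls-inside : ∀ {x} k → x ∈ N X k → ∃[ E ] (∀ l → radius l ℚ.≤ 1 /1+ E → x ∈ N X l →
                       ∃[ b ] StronglyInside l b k)
  small-balls-inside {x} k x∈k with ℝ≥0.rounded (d x (centre k)) x∈k
  ... | q , q<r , x<q with gap₂ q<r
  ...   | E , room = E , inside
    where
    fits : ∀ p → p ℚ.≤ 1 /1+ E → p ℚ.+ q ℚ.+ p ℚ.< radius k
    fits p small = ℚ.≤-<-trans
      (ℚ.+-mono-≤ (ℚ.≤-trans (ℚ.≤-reflexive (ℚ.+-comm p q)) (ℚ.+-monoʳ-≤ q small)) small) room

    inside : ∀ l → radius l ℚ.≤ 1 /1+ E → x ∈ N X l → ∃[ b ] StronglyInside l b k
    inside l small x∈l with d-tri (centre l) x (centre k) (d-sym x (centre l) x∈l) x<q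
    ... | dist with rational-surjective (ℝ≥0.positive (d (centre l) (centre k)) dist)
    ...   | b , eq = b , subst (d (centre l) (centre k) <ʳ_) (sym eq) dist ,
      subst (λ p → p ℚ.+ radius l ℚ.< radius k) (sym eq) (fits (radius l) small)

  ball-around : ∀ x r → ∃[ c ] x ∈ N X (ball c r)
  ball-around x r = let c , h = dense x (1 /1+ r) (0<1/1+ r) in c , to (N-ball X c r) h

  -- Ball k is the union, over the rationals q smaller than its radius, of the
  -- sets ∁ (⋃ N X l) with l ranging over the balls with Misses k q l.  For
  -- other q every l qualifies, so that these sets are empty.

  Misses : ℕ → ℕ → ℕ → Set
  Misses k q l = rational q ℚ.< radius k → ¬ d (centre l) (centre k) <ʳ rational q ℚ.+ radius l

  abstract
    missesᴿ : {a b c : Vec ℕ k → ℕ} → Recursive a → Recursive b → Recursive c →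
              RecursiveRel (λ v → Misses (a v) (b v) (c v))
    missesᴿ {a = a} {b} {c} ra rb rc = →ᴿ
      (<-/1+ᴿ (rb at-rec′ const 0) (rb at-rec′ const 1) (ra at-rec′ const 1) (ra at-rec′ const 2))
      (¬ᴿ (⇔ᴿ (λ v → mk⇔ (subst (d (centre (c v)) (centre (a v)) <ʳ_) (sym (+-/1+ (b v at 0) (b v at 1) (c v at 1) (c v at 2))))
                         (subst (d (centre (c v)) (centre (a v)) <ʳ_) (+-/1+ (b v at 0) (b v at 1) (c v at 1) (c v at 2))))
        (centre-distanceᴿ rc ra
          (comp₂ _+_ +-rec ((rb at-rec′ const 0) *-rec′ suc-rec (rc at-rec′ const 2))
                           ((rc at-rec′ const 1) *-rec′ suc-rec (rb at-rec′ const 1)))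
          (comp₂ _+_ +-rec (rc at-rec′ const 2) ((rb at-rec′ const 1) *-rec′ suc-rec (rc at-rec′ const 2))))))

  ∈⇒misses : ∀ {x} k → x ∈ N X k → ∃[ q ] (∀ l → Misses k q l → ¬ x ∈ N X l)
  ∈⇒misses {x} k x∈k with ℝ≥0.rounded (d x (centre k)) x∈k
  ... | q , q<r , x<q with rational-surjective (ℝ≥0.positive (d x (centre k)) x<q)
  ...   | s , refl = s , λ l miss x∈l → miss q<r (ℝ≥0.upward (d _ _) (d-tri _ _ _ (d-sym _ _ x∈l) x<q)
    (ℚ.≤-reflexive (ℚ.+-comm (radius l) (rational s))))

  -- If `x` were outside ball `k`, its distance from the centre would exceed q by a fixed margin. A
  -- small ball around `x` would then satisfy `Misses`, and yet contain `x`.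
  misses⇒∈ : ExcludedMiddle 0ℓ → ∀ {x} k q → (∀ l → Misses k q l → ¬ x ∈ N X l) → x ∈ N X k
  misses⇒∈ em {x} k q h with em {rational q ℚ.< radius k}
  ... | no q≮r  = let c , x∈l = ball-around x 0 in ⊥-elim (h (ball c 0) (λ q<r → ⊥-elim (q≮r q<r)) x∈l)
  ... | yes q<r = decidable-stable em λ x∉k →
    let e , room = gap₂ q<r
        c , x∈l  = ball-around x e
        l        = ball c e
        room′    = subst (λ r → rational q ℚ.+ r ℚ.+ r ℚ.< radius k) (sym (radius-ball c e)) room
    in h l (λ _ near → x∉k (ℝ≥0.upward (d x (centre k)) (d-tri x (centre l) (centre k) x∈l near)
         (ℚ.<⇒≤ (ℚ.<-respˡ-≃ (ℚ.+-comm (rational q ℚ.+ radius l) (radius l)) room′)))) x∈l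

-- Ordinals

mutual
  ≤ₒ-trans : ∀ α β γ → α ≤ₒ β → β ≤ₒ γ → α ≤ₒ γ
  ≤ₒ-trans 0ₒ       β γ _   _   = tt
  ≤ₒ-trans (sup⁺ α) β γ α≤β β≤γ = λ n → <-≤ₒ-trans (α n) β γ (α≤β n) β≤γ

  <-≤ₒ-trans : ∀ α β γ → α <ₒ β → β ≤ₒ γ → α <ₒ γ
  <-≤ₒ-trans α (sup⁺ β) γ (n , α≤βn) β≤γ = ≤-<ₒ-trans α (β n) γ α≤βn (β≤γ n)

  ≤-<ₒ-trans : ∀ α β γ → α ≤ₒ β → β <ₒ γ → α <ₒ γ
  ≤-<ₒ-trans α β (sup⁺ γ) α≤β (n , β≤γn) = n , ≤ₒ-trans α β (γ n) α≤β β≤γn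

≤ₒ-refl : ∀ α → α ≤ₒ α
≤ₒ-refl 0ₒ       = tt
≤ₒ-refl (sup⁺ α) = λ n → n , ≤ₒ-refl (α n)

<ₒ⇒≤ₒ : ∀ α β → α <ₒ β → α ≤ₒ β
<ₒ⇒≤ₒ 0ₒ       β        _         = tt
<ₒ⇒≤ₒ (sup⁺ α) (sup⁺ β) (n , α≤βn) = λ m → n , <ₒ⇒≤ₒ (α m) (β n) (α≤βn m)

2≰1 : ¬ 2ₒ ≤ₒ 1ₒ
2≰1 h = proj₂ (h 0) 0

module _ (em : ExcludedMiddle 0ℓ) where

  mutual
    ≤ₒ-or-> : ∀ α β → α ≤ₒ β ⊎ β <ₒ α
    ≤ₒ-or-> 0ₒ       β = inj₁ tt
    ≤ₒ-or-> (sup⁺ α) β with em {∃[ n ] β ≤ₒ α n}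
    ... | yes β<α = inj₂ β<α
    ... | no β≮α  = inj₁ λ n → [ id , (λ β≤αn → ⊥-elim (β≮α (n , β≤αn))) ]′ (<ₒ-or-≥ (α n) β)

    <ₒ-or-≥ : ∀ α β → α <ₒ β ⊎ β ≤ₒ α
    <ₒ-or-≥ α 0ₒ = inj₂ tt
    <ₒ-or-≥ α (sup⁺ β) with em {∃[ n ] α ≤ₒ β n}
    ... | yes α<β = inj₁ α<β
    ... | no α≮β  = inj₂ λ n → [ (λ α≤βn → ⊥-elim (α≮β (n , α≤βn))) , id ]′ (≤ₒ-or-> α (β n))

  -- The bound is one of the `η i`, since their strict supremum `sup⁺` may already reach ξ. Picking
  -- the largest uses the linearity of the order.
  finite-bound-below : ∀ {ξ} (η : ℕ → Ord) n → (∀ i → i ≤ n → η i <ₒ ξ) →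
                       ∃[ ζ ] (ζ <ₒ ξ × (∀ i → i ≤ n → η i ≤ₒ ζ))
  finite-bound-below η zero h = η 0 , h 0 z≤n , λ { .0 z≤n → ≤ₒ-refl (η 0) }
  finite-bound-below {ξ} η (suc n) h with finite-bound-below η n (λ i i≤n → h i (ℕ.m≤n⇒m≤1+n i≤n))
  ... | ζ , ζ<ξ , η≤ζ with ≤ₒ-or-> ζ (η (suc n))
  ...   | inj₁ ζ≤η = η (suc n) , h (suc n) ℕ.≤-refl , λ i i≤1+n → bound i (ℕ.m≤n⇒m<n∨m≡n i≤1+n)
    where
    bound : ∀ i → i < suc n ⊎ i ≡ suc n → η i ≤ₒ η (suc n)
    bound i (inj₁ i≤n)  = ≤ₒ-trans (η i) ζ _ (η≤ζ i (ℕ.≤-pred i≤n)) ζ≤η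
    bound i (inj₂ refl) = ≤ₒ-refl (η i)
  ...   | inj₂ η<ζ = ζ , ζ<ξ , λ i i≤1+n → bound i (ℕ.m≤n⇒m<n∨m≡n i≤1+n)
    where
    bound : ∀ i → i < suc n ⊎ i ≡ suc n → η i ≤ₒ ζ
    bound i (inj₁ i≤n)  = η≤ζ i (ℕ.≤-pred i≤n)
    bound i (inj₂ refl) = <ₒ⇒≤ₒ (η i) ζ η<ζ

-- Borel codes

module Codes (𝒢 : GoodParametrization) where
  open GoodParametrization 𝒢

  -- `G` is a union of balls, and the distance in `𝒩` depends only on values.
  G-resp : ∀ Z {γ δ : ℕ → ℕ} {z} → γ ≗ δ → (γ , z) ∈ G Z → (δ , z) ∈ G Z
  G-resp Z {γ} {δ} e g with G-Σ⁰₁ Z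
  ... | ε , _ , G⊆ , ⊆G with G⊆ g
  ...   | i , (0<q , h) , h′ = ⊆G (i , (0<q , λ n ne → h n (ne ∘ trans (sym (e n)))) , h′)

  Value-resp : ∀ {γ γ′ i} {δ : ℕ → ℕ} → γ ≗ γ′ → Value 𝒢 ω 𝒩 γ i δ → Value 𝒢 ω 𝒩 γ′ i δ
  Value-resp e h k = mk⇔ (G-resp (ω ⊗ ω) e ∘ to (h k)) (from (h k) ∘ G-resp (ω ⊗ ω) (sym ∘ e))

  Value-functional : ∀ {γ i} {δ δ′ : ℕ → ℕ} → Value 𝒢 ω 𝒩 γ i δ → Value 𝒢 ω 𝒩 γ i δ′ → δ ≗ δ′
  Value-functional {γ} {i} {δ} h h′ m = sym (to (readOff h′ m (δ m)) (from (readOff h m (δ m)) refl))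

  BC-resp : ∀ {ξ} {γ δ : ℕ → ℕ} → γ ≗ δ → γ ∈ BC 𝒢 ξ → δ ∈ BC 𝒢 ξ
  BC-resp e (base ξ≈1 γ0)          = base ξ≈1 (trans (sym (e 0)) γ0)
  BC-resp e (limit 2≤ξ γ0 δ v η b c) = limit 2≤ξ (trans (sym (e 0)) γ0) δ (λ i → Value-resp (e ∘ suc) (v i)) η b c

  module _ (X : PolishSpace) where

    ρ-unique : ∀ {ξ ζ} {γ δ : ℕ → ℕ} → γ ≗ δ → (c : γ ∈ BC 𝒢 ξ) (c′ : δ ∈ BC 𝒢 ζ) →
               ρ-BC 𝒢 X c ⊆ ρ-BC 𝒢 X c′
    ρ-unique e (base _ _) (base _ _) {x} (i , h) = i , subst (λ s → x ∈ N X s) (e (suc i)) h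
    ρ-unique e (base _ γ0) (limit _ δ0 _ _ _ _ _) with () ← trans (sym γ0) (trans (e 0) δ0)
    ρ-unique e (limit _ γ0 _ _ _ _ _) (base _ δ0) with () ← trans (sym γ0) (trans (e 0) δ0)
    ρ-unique e (limit _ _ _ v _ _ c) (limit _ _ _ v′ _ _ c′) (i , ∉c) =
      -- Complements reverse inclusions, so the two derivations change places.
      i , λ ∈c′ → ∉c (ρ-unique (Value-functional (v′ i) (Value-resp (e ∘ suc) (v i))) (c′ i) (c i) ∈c′)

    ρ-open : ∀ {ξ γ} → γ 0 ≡ 0 → (c : γ ∈ BC 𝒢 ξ) → ρ-BC 𝒢 X c ≐ (⋃[ i ∶ ℕ ] N X (shift γ i))
    ρ-open γ0 (base _ _) = id , id
    ρ-open γ0 (limit _ γ0′ _ _ _ _ _) with () ← trans (sym γ0) γ0′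

    ρ-limit : ∀ {ξ γ} {η : ℕ → Ord} {δ : ℕ → ℕ → ℕ} → γ 0 ≡ 1 → (c : γ ∈ BC 𝒢 ξ) →
              (∀ s → Value 𝒢 ω 𝒩 (shift γ) s (δ s)) → (c′ : ∀ s → δ s ∈ BC 𝒢 (η s)) →
              ρ-BC 𝒢 X c ≐ (⋃[ s ∶ ℕ ] ∁ (ρ-BC 𝒢 X (c′ s)))
    ρ-limit γ0 (base _ γ0′) v c′ with () ← trans (sym γ0) γ0′
    ρ-limit γ0 (limit _ _ _ v _ _ c) v′ c′ =
      (λ { (s , ∉c) → s , λ ∈c′ → ∉c (ρ-unique (Value-functional (v′ s) (v s)) (c′ s) (c s) ∈c′) }) ,
      (λ { (s , ∉c′) → s , λ ∈c → ∉c′ (ρ-unique (Value-functional (v s) (v′ s)) (c s) (c′ s) ∈c) })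

    open Balls X

    -- As a sequence in its last argument, missed κ q is the open code of the
    -- union of the balls with Misses κ q l; the initial 0 marks open codes.
    misses : RecursiveRel {3} (λ v → Misses (lookup v 0F) (lookup v 1F) (lookup v 2F))
    misses = missesᴿ (proj 0F) (proj 1F) (proj 2F)

    third : Vec ℕ 3 → ℕ
    third v = lookup v 2F

    missed : ℕ → ℕ → ℕ → ℕ
    missed κ q m = filter misses third (κ ∷ q ∷ pred m ∷ [])

    N-missed : ∀ κ q l {x} → (x ∈ N X (missed κ q (suc l))) ⇔ (Misses κ q l × x ∈ N X l)
    N-missed κ q l = N-filter X misses third (κ ∷ q ∷ l ∷ [])

    -- Open codes are put into limit form as well: for them `j` is read as the number of a ball
    -- together with a rational. Their components have rank 1, so the union of complements belongs
    -- to rank at least 2.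
    component : ∀ {ξ γ} → γ ∈ BC 𝒢 ξ → ℕ → ℕ → ℕ
    component {γ = γ} (base _ _) j      = λ m → missed (γ (suc (j at 0))) (j at 1) m
    component (limit _ _ δ _ _ _ _) j = δ j

    rank : ∀ {ξ γ} → γ ∈ BC 𝒢 ξ → ℕ → Ord
    rank (base _ _) j            = 1ₒ
    rank (limit _ _ _ _ η _ _) j = η j

    -- By `pred 0` = 0 the filtered value is 0 whether or not ball 0 satisfies `Misses`, so the head
    -- always marks an open code.
    missed-0 : ∀ κ q → missed κ q 0 ≡ 0
    missed-0 κ q = ℕ.*-zeroʳ (proj₁ misses (κ ∷ q ∷ 0 ∷ []))

    component-BC : ∀ {ξ γ} (c : γ ∈ BC 𝒢 ξ) j → component c j ∈ BC 𝒢 (rank c j)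
    component-BC {γ = γ} (base _ _) j            = base (≤ₒ-refl 1ₒ , ≤ₒ-refl 1ₒ) (missed-0 (γ (suc (j at 0))) (j at 1))
    component-BC (limit _ _ _ _ _ _ c) j = c j

    rank-bounds : ∀ {ξ ζ γ} → ξ ≤ₒ ζ → 2ₒ ≤ₒ ζ → (c : γ ∈ BC 𝒢 ξ) → ∀ j → 1ₒ ≤ₒ rank c j × rank c j <ₒ ζ
    rank-bounds ξ≤ζ 2≤ζ (base _ _) j            = ≤ₒ-refl 1ₒ , 2≤ζ 0
    rank-bounds ξ≤ζ 2≤ζ (limit _ _ _ _ η b _) j = proj₁ (b j) , <-≤ₒ-trans (η j) _ _ (proj₂ (b j)) ξ≤ζ

    ρ-components : ExcludedMiddle 0ℓ → ∀ {ξ γ} (c : γ ∈ BC 𝒢 ξ) →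
                   ρ-BC 𝒢 X c ≐ (⋃[ j ∶ ℕ ] ∁ (ρ-BC 𝒢 X (component-BC c j)))
    ρ-components em (limit _ _ _ _ _ _ _) = id , id
    ρ-components em {γ = γ} (base _ _) =
      (λ { {x} (i , h) → let q , h″ = ∈⇒misses (γ (suc i)) h
                             j          = λ { 0 → i ; _ → q }
                             e₀         = at-encode 2 j 0 (s≤s z≤n)
                             e₁         = at-encode 2 j 1 (s≤s (s≤s z≤n))
          in encode 2 j , subst₂ (λ i′ q′ → ¬ (∃[ l ] x ∈ N X (missed (γ (suc i′)) q′ (suc l)))) (sym e₀) (sym e₁)
               λ { (l , h′) → let p , x∈l = to (N-missed (γ (suc i)) q l) h′ in h″ l p x∈l } }) ,
      (λ { {x} (j , ∉) → j at 0 , misses⇒∈ em (γ (suc (j at 0))) (j at 1) (λ l p x∈l →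
         ∉ (l , from (N-missed (γ (suc (j at 0))) (j at 1) l) (p , x∈l))) })

-- Case distinctions

queryᴿ : {R : Pred (Vec ℕ (suc k)) 0ℓ} {q : Vec ℕ k → ℕ} → RecursiveRel R → Recursive q →
         SemiRecursive (λ v β → R (β (q v) ∷ v))
queryᴿ {R = R} {q} r rq = ⇔ˢ (λ v β → mk⇔ (λ { (_ , refl , p) → p }) (λ p → β (q v) , refl , p))
  (∃ˢ {P = λ w β → β (q (tail w)) ≡ lookup w 0F × R (lookup w 0F ∷ tail w)}
    (∧ˢ (queryˢ (∘-rec rq tail-rec₁) (proj 0F)) (recˢ (∘ᴿ r (∷-rec (proj 0F) tail-rec₁)))))

module _ {R : Pred (Vec ℕ (suc (suc k))) 0ℓ} (r : RecursiveRel R)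
         {q : Vec ℕ (suc k) → ℕ} (rq : Recursive q) {b : Vec ℕ k → ℕ} (rb : Recursive b) where

  Everywhere : Vec ℕ k → (ℕ → ℕ) → Set
  Everywhere v β = ∀ i → i < b v → R (β (q (i ∷ v)) ∷ i ∷ v)

  Fails : Vec ℕ k → (ℕ → ℕ) → Set
  Fails v β = ∃[ i ] (i < b v × ¬ R (β (q (i ∷ v)) ∷ i ∷ v))

  everywhereˢ : SemiRecursive Everywhere
  everywhereˢ = ∀<ˢ (queryᴿ r rq) rb

  failsˢ : SemiRecursive Fails
  failsˢ = ∃ˢ {P = λ w β → lookup w 0F < b (tail w) × ¬ R (β (q w) ∷ w)}
    (∧ˢ (recˢ (≤ᴿ (suc-rec (proj 0F)) (∘-rec rb tail-rec₁))) (queryᴿ (¬ᴿ r) rq))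

  decide : ∀ v β → Everywhere v β ⊎ Fails v β
  decide v β with ℕ.anyUpTo? (λ i → ¬? (RecursiveRel⇒Dec r (β (q (i ∷ v)) ∷ i ∷ v))) (b v)
  ... | yes f = inj₂ f
  ... | no ¬f = inj₁ λ i i<b → decidable-stable (RecursiveRel⇒Dec r _) λ ¬p → ¬f (i , i<b , ¬p)

  exclusive : ∀ v β → Everywhere v β → ¬ Fails v β
  exclusive v β e (i , i<b , ¬p) = ¬p (e i i<b)

choose : {A B : Set} → A ⊎ B → ℕ → ℕ → ℕ
choose (inj₁ _) m n = m
choose (inj₂ _) m n = n

choose-left : ∀ {A B : Set} (d : A ⊎ B) {m n} → ¬ B → choose d m n ≡ m
choose-left (inj₁ _) _  = refl
choose-left (inj₂ b) ¬b = ⊥-elim (¬b b)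

choose-right : ∀ {A B : Set} (d : A ⊎ B) {m n} → ¬ A → choose d m n ≡ n
choose-right (inj₁ a) ¬a = ⊥-elim (¬a a)
choose-right (inj₂ _) _  = refl

-- The function `d` need not be known to be recursive: since the cases are exclusive and `d`
-- exhausts them, the graph is described by `A` and `B` alone.
chooseˢ : {A B : Vec ℕ k → (ℕ → ℕ) → Set} {f g : Vec ℕ k → (ℕ → ℕ) → ℕ} {y : Vec ℕ k → ℕ} →
          SemiRecursive A → SemiRecursive B → (∀ v β → A v β → ¬ B v β) → (d : ∀ v β → A v β ⊎ B v β) →
          SemiRecursive (λ v β → f v β ≡ y v) → SemiRecursive (λ v β → g v β ≡ y v) →
          SemiRecursive (λ v β → choose (d v β) (f v β) (g v β) ≡ y v)
chooseˢ {k} {A} {B} {f} {g} {y} sa sb excl d sf sg = ⇔ˢ (λ v β → mk⇔ (fwd v β) (bwd v β)) (∨ˢ (∧ˢ sa sf) (∧ˢ sb sg))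
  where
  fwd : ∀ v β → (A v β × f v β ≡ y v) ⊎ (B v β × g v β ≡ y v) → choose (d v β) (f v β) (g v β) ≡ y v
  fwd v β h with d v β | h
  ... | inj₁ _ | inj₁ (_ , e) = e
  ... | inj₁ a | inj₂ (b , _) = ⊥-elim (excl v β a b)
  ... | inj₂ b | inj₁ (a , _) = ⊥-elim (excl v β a b)
  ... | inj₂ _ | inj₂ (_ , e) = e

  bwd : ∀ v β → choose (d v β) (f v β) (g v β) ≡ y v → (A v β × f v β ≡ y v) ⊎ (B v β × g v β ≡ y v)
  bwd v β e with d v β
  ... | inj₁ a = inj₁ (a , e)
  ... | inj₂ b = inj₂ (b , e)

infixr 5 _◂_

_◂_ : ℕ → (ℕ → ℕ) → ℕ → ℕ
(a ◂ f) zero    = a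
(a ◂ f) (suc m) = f m

◂ˢ : ∀ a {f : Vec ℕ k → (ℕ → ℕ) → ℕ → ℕ} → Graph f → Graph (λ v β → a ◂ f v β)
◂ˢ {k} a {f} sf = ⇔ˢ (λ w β → mk⇔ (fwd (lookup w 0F)) (bwd (lookup w 0F)))
  (∧ˢ (recˢ (→ᴿ zero? (≡ᴿ (const a) (proj 1F))))
      (→ˢ (¬ᴿ zero?) (value {f = f} sf tail-rec₂ (comp₁ pred pred-rec (proj 0F)) (proj 1F))))
  where
  zero? : RecursiveRel {suc (suc k)} (λ w → lookup w 0F ≡ 0)
  zero? = ≡ᴿ (proj 0F) (const 0)

  fwd : ∀ m {y} {h : ℕ → ℕ} → (m ≡ 0 → a ≡ y) × (m ≢ 0 → h (pred m) ≡ y) → (a ◂ h) m ≡ y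
  fwd zero    h = proj₁ h refl
  fwd (suc m) h = proj₂ h λ ()

  bwd : ∀ m {y} {h : ℕ → ℕ} → (a ◂ h) m ≡ y → (m ≡ 0 → a ≡ y) × (m ≢ 0 → h (pred m) ≡ y)
  bwd zero    e = (λ _ → e) , λ 0≢0 → ⊥-elim (0≢0 refl)
  bwd (suc m) e = (λ ()) , λ _ → e

-- Charts

pair : ℕ → ℕ → ℕ
pair a b = ⟨ a , ⟨ b , 0 ⟩ ⟩

pair-at-0 : ∀ a b → pair a b at 0 ≡ a
pair-at-0 a b = π₁-⟨⟩ a ⟨ b , 0 ⟩

pair-at-1 : ∀ a b → pair a b at 1 ≡ b
pair-at-1 a b = trans (cong π₁ (π₂-⟨⟩ a ⟨ b , 0 ⟩)) (π₁-⟨⟩ b 0)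

pair-rec : {a b : Vec ℕ k → ℕ} → Recursive a → Recursive b → Recursive (λ v → pair (a v) (b v))
pair-rec ra rb = ⟨⟩-rec ra (⟨⟩-rec rb (const 0))

record Near (Z : PolishSpace) (z : Point Z) (c L : ℕ) : Set where
  constructor near-by
  field
    distance : PolishSpace.d Z z (PolishSpace.pt Z c) <ʳ 1 /1+ L

open Near

near-pair : ∀ {X Y x y} a b {L} → Near X x a L → Near Y y b L → Near (X ⊗ Y) (x , y) (pair a b) L
near-pair {X} {Y} {x} {y} a b {L} h h′ = near-by
  (subst (λ a′ → PolishSpace.d X x (PolishSpace.pt X a′) <ʳ 1 /1+ L) (sym (pair-at-0 a b)) (distance h) ,
   subst (λ b′ → PolishSpace.d Y y (PolishSpace.pt Y b′) <ʳ 1 /1+ L) (sym (pair-at-1 a b)) (distance h′))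

near-pair⁻¹ : ∀ {X Y x y} a b {L} → Near (X ⊗ Y) (x , y) (pair a b) L → Near X x a L × Near Y y b L
near-pair⁻¹ {X} {Y} {x} {y} a b {L} (near-by (h , h′)) =
  near-by (subst (λ a′ → PolishSpace.d X x (PolishSpace.pt X a′) <ʳ 1 /1+ L) (pair-at-0 a b) h) ,
  near-by (subst (λ b′ → PolishSpace.d Y y (PolishSpace.pt Y b′) <ʳ 1 /1+ L) (pair-at-1 a b) h′)

module _ (A : CodedSet) where
  open CodedSet A

  near-discrete : ∀ {x c L} → x ≡ elt c → Near (discrete A) x c L
  near-discrete {L = L} refl = near-by (0<1/1+ L , λ x≢x → ⊥-elim (x≢x refl))

  -- Distinct points have distance 1, and no radius 1/(L+1) exceeds 1.
  near-discrete⁻¹ : ∀ {x c L} → Near (discrete A) x c L → x ≡ elt c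
  near-discrete⁻¹ {x} {c} {L} (near-by (_ , far)) = decidable-stable (x ≟ elt c) λ x≢c →
    ℕ.<⇒≱ (/1+-<⁻ {1} {0} {1} {L} (far x≢c)) (s≤s z≤n)

near-𝒩 : ∀ {γ c L} → (∀ i → i < suc L → γ i ≡ c at i) → Near 𝒩 γ c L
near-𝒩 h = near-by (from (𝒩-ball _ _) h)

near-𝒩⁻¹ : ∀ {γ c L} → Near 𝒩 γ c L → ∀ i → i < suc L → γ i ≡ c at i
near-𝒩⁻¹ (near-by h) = to (𝒩-ball _ _) h

⊤ᴿ : RecursiveRel {k} (λ _ → 0 ≤ 0)
⊤ᴿ = ≤ᴿ (const 0) (const 0)

codes-chart : Chart ((ω ⊗ 𝒩) ⊗ (ω ⊗ ω)) 3
codes-chart = record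
  { numbers    = λ { ((n , β) , s , j) → n ∷ s ∷ j ∷ [] }
  ; oracle     = λ { ((n , β) , s , j) → β }
  ; centre     = λ w → pair (pair (lookup w 1F) (lookup w 0F)) (pair (lookup w 2F) (lookup w 3F))
  ; centre-rec = pair-rec (pair-rec (proj 1F) (proj 0F)) (pair-rec (proj 2F) (proj 3F))
  ; valid-rec  = ⊤ᴿ
  ; valid      = λ _ → z≤n
  ; near       = λ { ((n , β) , s , j) c L h → distance
      (near-pair (pair n c) (pair s j)
        (near-pair n c (near-discrete ℕ-coded refl) (near-𝒩 h))
        (near-pair s j (near-discrete ℕ-coded refl) (near-discrete ℕ-coded refl))) }
  ; near⁻¹     = λ { ((n , β) , s , j) c L (n′ ∷ s′ ∷ j′ ∷ []) _ h →
      let hl , hr = near-pair⁻¹ (pair n′ c) (pair s′ j′) (near-by h)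
          hn , hβ = near-pair⁻¹ n′ c hl
          hs , hj = near-pair⁻¹ s′ j′ hr
      in sym (cong₂ _∷_ (near-discrete⁻¹ ℕ-coded hn) (cong₂ (λ s j → s ∷ j ∷ [])
           (near-discrete⁻¹ ℕ-coded hs) (near-discrete⁻¹ ℕ-coded hj))) , near-𝒩⁻¹ hβ }
  }

arguments-chart : Chart ((𝟚 ⊗ ω ⊗ 𝒩) ⊗ ω) 3
arguments-chart = record
  { numbers    = λ { ((a , n , γ) , j) → toℕ a ∷ n ∷ j ∷ [] }
  ; oracle     = λ { ((a , n , γ) , j) → γ }
  ; centre     = λ w → pair (pair (lookup w 1F) (pair (lookup w 2F) (lookup w 0F))) (lookup w 3F)
  ; centre-rec = pair-rec (pair-rec (proj 1F) (pair-rec (proj 2F) (proj 0F))) (proj 3F)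
  -- Every positive number names the bit 1; only entries at most 1 are determined by the point.
  ; valid-rec  = ≤ᴿ (proj 0F) (const 1)
  ; valid      = λ { ((a , n , γ) , j) → ℕ.≤-pred (Fin.toℕ<n a) }
  ; near       = λ { ((a , n , γ) , j) c L h → distance
      (near-pair (pair (toℕ a) (pair n c)) j
        (near-pair (toℕ a) (pair n c) (near-discrete 2-coded (sym (CodedSet.elt∘code 2-coded a)))
          (near-pair n c (near-discrete ℕ-coded refl) (near-𝒩 h)))
        (near-discrete ℕ-coded refl)) }
  ; near⁻¹     = λ { ((a , n , γ) , j) c L (a′ ∷ n′ ∷ j′ ∷ []) a′≤1 h →
      let hl , hj = near-pair⁻¹ (pair a′ (pair n′ c)) j′ (near-by h)
          ha , hr = near-pair⁻¹ a′ (pair n′ c) hl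
          hn , hγ = near-pair⁻¹ n′ c hr
      in sym (cong₂ _∷_ (trans (cong toℕ (near-discrete⁻¹ 2-coded ha)) (toℕ-bit a′ a′≤1))
           (cong₂ (λ n j → n ∷ j ∷ []) (near-discrete⁻¹ ℕ-coded hn) (near-discrete⁻¹ ℕ-coded hj))) , near-𝒩⁻¹ hγ }
  }
  where
  toℕ-bit : ∀ a → a ≤ 1 → toℕ (CodedSet.elt 2-coded a) ≡ a
  toℕ-bit zero          _ = refl
  toℕ-bit (suc zero)    _ = refl
  toℕ-bit (suc (suc _)) (s≤s ())

-- Codes of the values of a computable family

-- Cantor pairing replaces the pairing behind `column`, because `selection` has to split an index
-- into row and place, which `π₁` and `π₂` do recursively.
row : (ℕ → ℕ) → ℕ → ℕ → ℕ
row β i m = β ⟨ i , m ⟩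

oracle-graph : Graph {k} (λ _ β → β)
oracle-graph = queryˢ (proj 0F) (proj 1F)

shifted-row-graph : {i : Vec ℕ k → ℕ} → Recursive i → Graph (λ v β → shift (row β (i v)))
shifted-row-graph ri = queryˢ (⟨⟩-rec (∘-rec ri tail-rec₂) (suc-rec (proj 0F))) (proj 1F)

module Parametrization (𝒢 : GoodParametrization) where
  open GoodParametrization 𝒢

  private
    first-four : Vec ℕ 5 → Vec ℕ 4
    first-four v = lookup v 0F ∷ lookup v 1F ∷ lookup v 2F ∷ lookup v 3F ∷ []

  abstract
    -- As a Σ⁰₁ set, `P` has a recursive index `e`, and s-m-n freezes `n` and `β` in it. With `e`
    -- constant, the resulting sequence depends computably on `n` and `β`.
    parametrize : {P : Vec ℕ 3 → (ℕ → ℕ) → Set} → SemiRecursive P →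
      Σ[ f ∈ (Vec ℕ 1 → (ℕ → ℕ) → ℕ → ℕ) ] Σ[ _ ∈ Graph f ]
        (∀ n β s j → ((f (n ∷ []) β , s , j) ∈ G (ω ⊗ ω)) ⇔ P (n ∷ s ∷ j ∷ []) β)
    parametrize {P} p =
      let e , re , P⊆ , ⊆P = to (Σ⁰₁-iff ((ω ⊗ 𝒩) ⊗ (ω ⊗ ω)) (Realized codes-chart P))
                                (semiRecursive⇒Σ⁰₁ ((ω ⊗ 𝒩) ⊗ (ω ⊗ ω)) codes-chart p)
          S , rS , S-spec  = s-m-n (ω ⊗ 𝒩) (ω ⊗ ω) (⊗-type ω-type 𝒩-type)
      in (λ v β → S (e , lookup v 0F , β)) ,
         image-graph (𝒩 ⊗ (ω ⊗ 𝒩)) {f = S} {z = λ v β → e , lookup v 0F , β} rS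
           (⊗-computable 𝒩 (ω ⊗ 𝒩) (𝒩-computable {f = λ _ _ → e} (recˢ (≡ᴿ (comp₁ e re (proj 0F)) (proj 1F))))
             (⊗-computable ω 𝒩 (ω-computable (proj 0F)) (𝒩-computable {f = λ _ β → β} oracle-graph))) ,
         λ n β s j → mk⇔ (λ h → ⊆P (from (S-spec e (n , β) (s , j)) h))
                         (λ h → to (S-spec e (n , β) (s , j)) (P⊆ {(n , β) , s , j} h))

    -- The code `f` is fixed for all `n` and `β` at once; it is only claimed to have a value at
    -- those `s` where `Γ` is the graph of some `δ`. Its section lists the balls that `InBall`
    -- accepts.
    tabulated : {Γ : Vec ℕ 4 → (ℕ → ℕ) → Set} → SemiRecursive Γ →
      Σ[ f ∈ (Vec ℕ 1 → (ℕ → ℕ) → ℕ → ℕ) ] Σ[ _ ∈ Graph f ]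
        (∀ n β s (δ : ℕ → ℕ) → (∀ m y → Γ (m ∷ y ∷ n ∷ s ∷ []) β ⇔ (δ m ≡ y)) →
            Value 𝒢 ω 𝒩 (f (n ∷ []) β) s δ)
    tabulated {Γ} γ = value-code (parametrize (inBallˢ {Γ = λ v → Γ (first-four v)}
      (∘ˢ γ (∷-rec (proj 0F) (∷-rec (proj 1F) (∷-rec (proj 2F) (∷-rec (proj 3F) []-rec)))))
      (proj 2F at-rec′ const 0) (proj 2F at-rec′ const 1) (proj 2F at-rec′ const 2)))
      where
      value-code :
        Σ[ f ∈ (Vec ℕ 1 → (ℕ → ℕ) → ℕ → ℕ) ] Σ[ _ ∈ Graph f ]
          (∀ n β s j → ((f (n ∷ []) β , s , j) ∈ G (ω ⊗ ω)) ⇔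
            InBall (λ m y → Γ (m ∷ y ∷ n ∷ s ∷ []) β) (j at 0) (j at 1) (j at 2)) →
        Σ[ f ∈ (Vec ℕ 1 → (ℕ → ℕ) → ℕ → ℕ) ] Σ[ _ ∈ Graph f ]
          (∀ n β s (δ : ℕ → ℕ) → (∀ m y → Γ (m ∷ y ∷ n ∷ s ∷ []) β ⇔ (δ m ≡ y)) →
            Value 𝒢 ω 𝒩 (f (n ∷ []) β) s δ)
      value-code (f , rf , spec) = f , rf , λ n β s δ Γ⇔δ j →
        let e₁ = inBall {δ} {j at 0} {j at 1} {j at 2}
            e₂ = InBall-cong {c = j at 0} {j at 1} {j at 2} Γ⇔δ
        in mk⇔ (λ h → from (spec n β s j) (from e₂ (to e₁ h))) (λ h → from e₁ (to e₂ (to (spec n β s j) h)))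

⊓-rec : {a b : Vec ℕ k → ℕ} → Recursive a → Recursive b → Recursive (λ v → a v ⊓ b v)
⊓-rec {a = a} {b} ra rb = ext (λ v → m∸[m∸n]≡m⊓n (a v) (b v)) (comp₂ _∸_ ∸-rec ra (comp₂ _∸_ ∸-rec ra rb))
  where
  m∸[m∸n]≡m⊓n : ∀ m n → m ∸ (m ∸ n) ≡ m ⊓ n
  m∸[m∸n]≡m⊓n m n with ℕ.≤-total m n
  ... | inj₁ m≤n = trans (cong (m ∸_) (ℕ.m≤n⇒m∸n≡0 m≤n)) (sym (ℕ.m≤n⇒m⊓n≡m m≤n))
  ... | inj₂ n≤m = trans (ℕ.m∸[m∸n]≡n n≤m) (sym (ℕ.m≥n⇒m⊓n≡n n≤m))

⊓-idem : ∀ i n → (i ⊓ n) ⊓ n ≡ i ⊓ n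
⊓-idem i n = ℕ.m≤n⇒m⊓n≡m (ℕ.m⊓n≤n i n)

quadruple : ∀ a b c d → ∃[ t ] (t at 0 ≡ a × t at 1 ≡ b × t at 2 ≡ c × t at 3 ≡ d)
quadruple a b c d = encode 4 x , at-encode 4 x 0 (s≤s z≤n) , at-encode 4 x 1 (s≤s (s≤s z≤n)) ,
  at-encode 4 x 2 (s≤s (s≤s (s≤s z≤n))) , at-encode 4 x 3 (s≤s (s≤s (s≤s (s≤s z≤n))))
  where
  x : ℕ → ℕ
  x 0 = a
  x 1 = b
  x 2 = c
  x _ = d

-- The columns of an oracle, and definition by cases

^-rec : {a : Vec ℕ k → ℕ} → Recursive a → Recursive (λ v → 2 ^ a v)
^-rec ra = comp₁ (2 ^_) (primrec {f = λ _ → 1} (const 1) (const 2 *-rec′ proj 1F) (λ _ → refl) (λ _ _ → refl)) ra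

Σ⁰₁-resp : ∀ Z {P Q : Pred (Point Z) 0ℓ} → P ≐ Q → Σ⁰₁ Z P → Σ⁰₁ Z Q
Σ⁰₁-resp Z (P⊆Q , Q⊆P) (ε , rε , P⊆ , ⊆P) = ε , rε , (λ q → P⊆ (Q⊆P q)) , (λ h → P⊆Q (⊆P h))

columns : ℕ → (ℕ → ℕ) → ℕ → ℕ
columns n γ q = column γ (π₁ q ⊓ n) (π₂ q)

row-columns : ∀ n γ i → row (columns n γ) i ≗ column γ (i ⊓ n)
row-columns n γ i m = cong₂ (λ i m → column γ (i ⊓ n) m) (π₁-⟨⟩ i m) (π₂-⟨⟩ i m)

columns-graph : Graph {1} (λ v γ → columns (lookup v 0F) γ)
columns-graph = queryˢ
  (comp₂ _∸_ ∸-rec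
    (^-rec (⊓-rec (comp₁ π₁ π₁-rec (proj 0F)) (∘-rec (proj 0F) tail-rec₂)) *-rec′
      comp₂ _+_ +-rec (const 2 *-rec′ comp₁ π₂ π₂-rec (proj 0F)) (const 1))
    (const 1))
  (proj 1F)

on-columns-graph : {f : Vec ℕ 1 → (ℕ → ℕ) → ℕ → ℕ} → Graph f → Graph (λ v γ → f v (columns (lookup v 0F) γ))
on-columns-graph {f} rf = ⇔ˢ
  (λ w γ → substituted {Γ = Γ} rf {w} {γ} {columns (lookup (tail (tail w)) 0F) γ} (λ i y → mk⇔ id id))
  (substˢ {Γ = Γ} rf (∘ˢ columns-graph (∷-rec (proj 0F) (∷-rec (proj 1F) (tail-rec (tail-rec tail-rec₂))))))
  where
  Γ : Vec ℕ 5 → (ℕ → ℕ) → Set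
  Γ w γ = columns (lookup (tail (tail (tail (tail w)))) 0F) γ (lookup w 0F) ≡ lookup w 1F

byBit : {A : Set} → A → A → Fin 2 → A
byBit x y 0F = x
byBit x y 1F = y

module _ {f g : Vec ℕ 1 → (ℕ → ℕ) → ℕ → ℕ} where

  private
    InN : (Vec ℕ 1 → (ℕ → ℕ) → ℕ → ℕ) → Vec ℕ 3 → (ℕ → ℕ) → Set
    InN h v γ = h (lookup v 1F ∷ []) (columns (lookup v 1F) γ) ∈ N 𝒩 (lookup v 2F)

    inNˢ : ∀ {h} → Graph h → SemiRecursive (InN h)
    inNˢ {h} rh = Computable.within (𝒩-computable {f = λ v γ → h v (columns (lookup v 0F) γ)} (on-columns-graph {f = h} rh))
      (∷-rec (proj 1F) []-rec) (proj 2F at-rec′ const 0) (proj 2F at-rec′ const 1) (proj 2F at-rec′ const 2)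

    Chosen : Vec ℕ 3 → (ℕ → ℕ) → Set
    Chosen v γ = (lookup v 0F ≡ 0 → InN f v γ) × (lookup v 0F ≢ 0 → InN g v γ)

    zero? : RecursiveRel {3} (λ v → lookup v 0F ≡ 0)
    zero? = ≡ᴿ (proj 0F) (const 0)

    chosen : Graph f → Graph g → SemiRecursive Chosen
    chosen rf rg = ∧ˢ (→ˢ zero? (inNˢ {f} rf)) (→ˢ (¬ᴿ zero?) (inNˢ {g} rg))

    u : Point (𝟚 ⊗ ω ⊗ 𝒩) → ℕ → ℕ
    u (a , n , γ) = byBit f g a (n ∷ []) (columns n γ)

    chosen⇒ : ∀ a n γ j → Chosen (toℕ a ∷ n ∷ j ∷ []) γ → u (a , n , γ) ∈ N 𝒩 j
    chosen⇒ 0F n γ j h = proj₁ h refl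
    chosen⇒ 1F n γ j h = proj₂ h λ ()

    ⇒chosen : ∀ a n γ j → u (a , n , γ) ∈ N 𝒩 j → Chosen (toℕ a ∷ n ∷ j ∷ []) γ
    ⇒chosen 0F n γ j h = (λ _ → h) , λ 0≢0 → ⊥-elim (0≢0 refl)
    ⇒chosen 1F n γ j h = (λ ()) , λ _ → h

  by-bit-recursive : Graph f → Graph g → RecursiveMap (𝟚 ⊗ ω ⊗ 𝒩) 𝒩 (λ { (a , n , γ) → byBit f g a (n ∷ []) (columns n γ) })
  by-bit-recursive rf rg = Σ⁰₁-resp ((𝟚 ⊗ ω ⊗ 𝒩) ⊗ ω)
    ((λ { {(a , n , γ) , j} → chosen⇒ a n γ j }) , (λ { {(a , n , γ) , j} → ⇒chosen a n γ j }))
    (semiRecursive⇒Σ⁰₁ ((𝟚 ⊗ ω ⊗ 𝒩) ⊗ ω) arguments-chart (chosen rf rg))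

columns-clipped : ∀ n γ i → row (columns n γ) i ≗ row (columns n γ) (i ⊓ n)
columns-clipped n γ i m = trans (row-columns n γ i m)
  (trans (cong (λ i → column γ i m) (sym (⊓-idem i n))) (sym (row-columns n γ (i ⊓ n) m)))

-- Finite unions and intersections of the rows of β.  Rows with index above n
-- repeat row n, so that nothing but the case distinction on the first
-- entries of the codes depends on n.

module Construction (em : ExcludedMiddle 0ℓ) (𝒢 : GoodParametrization) (X : PolishSpace) where
  open GoodParametrization 𝒢
  open Codes 𝒢
  open Parametrization 𝒢
  open Balls X

  -- The j-th component of the code in row i takes the value y at m.

  Member : (ℕ → ℕ) → ℕ → ℕ → ℕ → ℕ → Set
  Member β i j m y =
    (β ⟨ i , 0 ⟩ ≡ 0 × ∃[ κ ] (β ⟨ i , suc (j at 0) ⟩ ≡ κ × missed X κ (j at 1) m ≡ y)) ⊎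
    (β ⟨ i , 0 ⟩ ≡ 1 × ReadOff (λ s → (shift (row β i) , j , s) ∈ G (ω ⊗ ω)) m y)

  missed-rec : {a b c : Vec ℕ k → ℕ} → Recursive a → Recursive b → Recursive c →
               Recursive (λ v → missed X (a v) (b v) (c v))
  missed-rec {a = a} {b} {c} ra rb rc = ∘-rec {g = λ v → a v ∷ b v ∷ pred (c v) ∷ []}
    (filter-rec {a = third X} (misses X) (proj 2F))
    (∷-rec ra (∷-rec rb (∷-rec (comp₁ pred pred-rec rc) []-rec)))

  memberˢ : {i j m y : Vec ℕ k → ℕ} → Recursive i → Recursive j → Recursive m → Recursive y →
            SemiRecursive (λ v β → Member β (i v) (j v) (m v) (y v))
  memberˢ {i = i} ri rj rm ry = ∨ˢ
    (∧ˢ (queryˢ (⟨⟩-rec ri (const 0)) (const 0))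
        (∃ˢ (∧ˢ (queryˢ (∘-rec (⟨⟩-rec ri (suc-rec (rj at-rec′ const 0))) tail-rec₁) (proj 0F))
                (recˢ (≡ᴿ (missed-rec (proj 0F) (∘-rec (rj at-rec′ const 1) tail-rec₁) (∘-rec rm tail-rec₁))
                          (∘-rec ry tail-rec₁))))))
    (∧ˢ (queryˢ (⟨⟩-rec ri (const 0)) (const 1))
        (readOffˢ (Σ⁰₁ˢ (𝒩 ⊗ ω ⊗ ω) (G-Σ⁰₁ (ω ⊗ ω))
          (⊗-computable 𝒩 (ω ⊗ ω)
            (𝒩-computable {f = λ w β → shift (row β (i (tail w)))} (shifted-row-graph (∘-rec ri tail-rec₁)))
            (⊗-computable ω ω (ω-computable (∘-rec rj tail-rec₁)) (ω-computable (proj 0F))))) rm ry))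

  member : ∀ β i {ξ} (c : row β i ∈ BC 𝒢 ξ) j m y → Member β i j m y ⇔ (component X c j m ≡ y)
  member β i (base _ β0) j m y = mk⇔
    (λ { (inj₁ (_ , _ , refl , e)) → e
       ; (inj₂ (β1 , _)) → ⊥-elim (ℕ.0≢1+n (trans (sym β0) β1)) })
    (λ e → inj₁ (β0 , _ , refl , e))
  member β i (limit _ β1 δ v _ _ _) j m y = mk⇔
    (λ { (inj₁ (β0 , _)) → ⊥-elim (ℕ.0≢1+n (trans (sym β0) β1))
       ; (inj₂ (_ , h)) → to (readOff (v j) m y) h })
    (λ e → inj₂ (β1 , from (readOff (v j) m y) e))

  heads-zero : RecursiveRel {3} (λ w → lookup w 0F ≡ 0)
  heads-zero = ≡ᴿ (proj 0F) (const 0)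

  head-index : Recursive {2} (λ w → ⟨ lookup w 0F , 0 ⟩)
  head-index = ⟨⟩-rec (proj 0F) (const 0)

  up-to : Recursive {1} (λ v → suc (lookup v 0F))
  up-to = suc-rec (proj 0F)

  -- For codes a nonzero head equals 1; stating the second case as the exact negation of the first
  -- keeps the choice total for arbitrary `β`.
  AllOpen SomeLimit : ℕ → (ℕ → ℕ) → Set
  AllOpen n β = Everywhere heads-zero head-index up-to (n ∷ []) β
  SomeLimit n β = Fails heads-zero head-index up-to (n ∷ []) β

  allOpen-or-someLimit : ∀ v β → Everywhere heads-zero head-index up-to v β ⊎ Fails heads-zero head-index up-to v β
  allOpen-or-someLimit = decide heads-zero head-index up-to

  -- In the open case `o` enumerates balls; in the limit case `f` codes the sequence of components.
  -- The entry put in front is the head that tells the two kinds of code apart.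
  assemble : (o f : Vec ℕ 1 → (ℕ → ℕ) → ℕ → ℕ) → Vec ℕ 1 → (ℕ → ℕ) → ℕ → ℕ
  assemble o f v β m = choose (allOpen-or-someLimit v β) ((0 ◂ o v β) m) ((1 ◂ f v β) m)

  assemble-graph : ∀ {o f} → Graph o → Graph f → Graph (assemble o f)
  assemble-graph {o} {f} ro rf = chooseˢ
    (∘ˢ (everywhereˢ heads-zero head-index up-to) tail-rec₂) (∘ˢ (failsˢ heads-zero head-index up-to) tail-rec₂)
    (λ w β → exclusive heads-zero head-index up-to (tail (tail w)) β)
    (λ w β → allOpen-or-someLimit (tail (tail w)) β) (◂ˢ 0 {f = o} ro) (◂ˢ 1 {f = f} rf)

  module _ {o f : Vec ℕ 1 → (ℕ → ℕ) → ℕ → ℕ} {n : ℕ} {β : ℕ → ℕ} where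

    assemble-open : AllOpen n β → assemble o f (n ∷ []) β ≗ 0 ◂ o (n ∷ []) β
    assemble-open h m = choose-left (allOpen-or-someLimit (n ∷ []) β) (exclusive heads-zero head-index up-to (n ∷ []) β h)

    assemble-limit : SomeLimit n β → assemble o f (n ∷ []) β ≗ 1 ◂ f (n ∷ []) β
    assemble-limit h m = choose-right (allOpen-or-someLimit (n ∷ []) β) (λ h′ → exclusive heads-zero head-index up-to (n ∷ []) β h′ h)

  -- Finite unions

  openUnion : Vec ℕ 1 → (ℕ → ℕ) → ℕ → ℕ
  openUnion _ β t = β ⟨ t at 0 , suc (t at 1) ⟩

  openUnion-graph : Graph openUnion
  openUnion-graph = queryˢ (⟨⟩-rec (proj 0F at-rec′ const 0) (suc-rec (proj 0F at-rec′ const 1))) (proj 1F)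

  unionMember : Σ[ f ∈ (Vec ℕ 1 → (ℕ → ℕ) → ℕ → ℕ) ] Σ[ _ ∈ Graph f ]
    (∀ n β s (δ : ℕ → ℕ) → (∀ m y → Member β (s at 0) (s at 1) m y ⇔ (δ m ≡ y)) → Value 𝒢 ω 𝒩 (f (n ∷ []) β) s δ)
  unionMember = tabulated {Γ = λ v β → Member β (lookup v 3F at 0) (lookup v 3F at 1) (lookup v 0F) (lookup v 1F)}
    (memberˢ (proj 3F at-rec′ const 0) (proj 3F at-rec′ const 1) (proj 0F) (proj 1F))

  union : Vec ℕ 1 → (ℕ → ℕ) → ℕ → ℕ
  union = assemble openUnion (proj₁ unionMember)

  union-graph : Graph union
  union-graph = assemble-graph {o = openUnion} {f = proj₁ unionMember} openUnion-graph (proj₁ (proj₂ unionMember))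

  Clipped : ℕ → (ℕ → ℕ) → Set
  Clipped n β = ∀ i → row β i ≗ row β (i ⊓ n)

  -- The test inspects rows up to `n` only, whereas `openUnion` enumerates balls from every row.
  allOpen-heads : ∀ n β → Clipped n β → AllOpen n β → ∀ i → row β i 0 ≡ 0
  allOpen-heads n β clip h i = trans (clip i 0) (h (i ⊓ n) (s≤s (ℕ.m⊓n≤n i n)))

  someLimit-rank : ∀ n β {ζ} {ξ : ℕ → Ord} → (∀ i → row β i ∈ BC 𝒢 (ξ i)) → (∀ i → ξ i ≤ₒ ζ) →
                   SomeLimit n β → 2ₒ ≤ₒ ζ
  someLimit-rank n β {ζ} {ξ} c ξ≤ζ (i , _ , h) = rank≥2 (c i) h
    where
    rank≥2 : ∀ {γ} → γ ∈ BC 𝒢 (ξ i) → γ 0 ≢ 0 → 2ₒ ≤ₒ ζ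
    rank≥2 (base _ γ0) h              = ⊥-elim (h γ0)
    rank≥2 (limit 2≤ξ _ _ _ _ _ _) _ = ≤ₒ-trans 2ₒ (ξ i) ζ 2≤ξ (ξ≤ζ i)

  module _ {n : ℕ} {β : ℕ → ℕ} {o f : Vec ℕ 1 → (ℕ → ℕ) → ℕ → ℕ} where

    assemble-BC-open : AllOpen n β → assemble o f (n ∷ []) β ∈ BC 𝒢 1ₒ
    assemble-BC-open h = BC-resp (sym ∘ assemble-open {o} {f} h) (base (≤ₒ-refl 1ₒ , ≤ₒ-refl 1ₒ) refl)

    assemble-BC-limit : ∀ {ζ} {δ : ℕ → ℕ → ℕ} → SomeLimit n β → 2ₒ ≤ₒ ζ → (∀ s → Value 𝒢 ω 𝒩 (f (n ∷ []) β) s (δ s)) →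
                        (∀ s → ∃[ η ] ((1ₒ ≤ₒ η × η <ₒ ζ) × δ s ∈ BC 𝒢 η)) → assemble o f (n ∷ []) β ∈ BC 𝒢 ζ
    assemble-BC-limit h 2≤ζ v c = BC-resp (sym ∘ assemble-limit {o} {f} h)
      (limit 2≤ζ refl _ v (λ s → proj₁ (c s)) (λ s → proj₁ (proj₂ (c s))) (λ s → proj₂ (proj₂ (c s))))

    assemble-ρ-open : ∀ {ξ} → AllOpen n β → (c : assemble o f (n ∷ []) β ∈ BC 𝒢 ξ) →
                      ρ-BC 𝒢 X c ≐ (⋃[ t ∶ ℕ ] N X (o (n ∷ []) β t))
    assemble-ρ-open h c = ρ-open-resp (ρ-open X (assemble-open {o} {f} h 0) c)
      where
      ρ-open-resp : ∀ {A : Pred (Point X) 0ℓ} → A ≐ (⋃[ t ∶ ℕ ] N X (shift (assemble o f (n ∷ []) β) t)) →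
                    A ≐ (⋃[ t ∶ ℕ ] N X (o (n ∷ []) β t))
      ρ-open-resp (A⊆ , ⊆A) =
        (λ {x} a → let t , x∈ = A⊆ a in t , subst (λ l → x ∈ N X l) (assemble-open {o} {f} h (suc t)) x∈) ,
        (λ { {x} (t , x∈) → ⊆A (t , subst (λ l → x ∈ N X l) (sym (assemble-open {o} {f} h (suc t))) x∈) })

    assemble-ρ-limit : ∀ {ξ} {η : ℕ → Ord} {δ : ℕ → ℕ → ℕ} → SomeLimit n β →
                       (c : assemble o f (n ∷ []) β ∈ BC 𝒢 ξ) →
                       (∀ s → Value 𝒢 ω 𝒩 (f (n ∷ []) β) s (δ s)) → (c′ : ∀ s → δ s ∈ BC 𝒢 (η s)) →
                       ρ-BC 𝒢 X c ≐ (⋃[ s ∶ ℕ ] ∁ (ρ-BC 𝒢 X (c′ s)))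
    assemble-ρ-limit h c v c′ = ρ-limit X (assemble-limit {o} {f} h 0) c
      (λ s → Value-resp (sym ∘ assemble-limit {o} {f} h ∘ suc) (v s)) c′

  module Union {n : ℕ} {β : ℕ → ℕ} {ξ : ℕ → Ord} (c : ∀ i → row β i ∈ BC 𝒢 (ξ i)) where

    union-value : ∀ s → Value 𝒢 ω 𝒩 (proj₁ unionMember (n ∷ []) β) s (component X (c (s at 0)) (s at 1))
    union-value s = proj₂ (proj₂ unionMember) n β s (component X (c (s at 0)) (s at 1)) (member β (s at 0) (c (s at 0)) (s at 1))

    union-BC-limit : ∀ {ζ} → (∀ i → ξ i ≤ₒ ζ) → SomeLimit n β → union (n ∷ []) β ∈ BC 𝒢 ζ
    union-BC-limit ξ≤ζ h = assemble-BC-limit {o = openUnion} {proj₁ unionMember} h 2≤ζ union-value λ s →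
      rank X (c (s at 0)) (s at 1) , rank-bounds X (ξ≤ζ (s at 0)) 2≤ζ (c (s at 0)) (s at 1) ,
      component-BC X (c (s at 0)) (s at 1)
      where
      2≤ζ = someLimit-rank n β c ξ≤ζ h

    union-ρ-open : Clipped n β → AllOpen n β → ∀ {ζ} (c′ : union (n ∷ []) β ∈ BC 𝒢 ζ) →
                   ρ-BC 𝒢 X c′ ≐ (⋃[ i ∶ ℕ ] ρ-BC 𝒢 X (c i))
    union-ρ-open clip h c′ = equal (assemble-ρ-open {o = openUnion} {proj₁ unionMember} h c′)
      where
      row-ρ : ∀ i → ρ-BC 𝒢 X (c i) ≐ (⋃[ j ∶ ℕ ] N X (β ⟨ i , suc j ⟩))
      row-ρ i = ρ-open X (allOpen-heads n β clip h i) (c i)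

      equal : ∀ {A : Pred (Point X) 0ℓ} → A ≐ (⋃[ t ∶ ℕ ] N X (β ⟨ t at 0 , suc (t at 1) ⟩)) →
              A ≐ (⋃[ i ∶ ℕ ] ρ-BC 𝒢 X (c i))
      equal (A⊆ , ⊆A) =
        (λ a → let t , x∈ = A⊆ a in t at 0 , proj₂ (row-ρ (t at 0)) (t at 1 , x∈)) ,
        (λ { {x} (i , x∈) → let j , x∈N = proj₁ (row-ρ i) x∈ in
             ⊆A (pair i j , subst₂ (λ i j → x ∈ N X (β ⟨ i , suc j ⟩)) (sym (pair-at-0 i j)) (sym (pair-at-1 i j)) x∈N) })

    union-ρ-limit : SomeLimit n β → ∀ {ζ} (c′ : union (n ∷ []) β ∈ BC 𝒢 ζ) →
                    ρ-BC 𝒢 X c′ ≐ (⋃[ i ∶ ℕ ] ρ-BC 𝒢 X (c i))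
    union-ρ-limit h c′ = equal (assemble-ρ-limit {o = openUnion} {proj₁ unionMember} h c′ union-value
                           (λ s → component-BC X (c (s at 0)) (s at 1)))
      where
      equal : ∀ {A : Pred (Point X) 0ℓ} → A ≐ (⋃[ s ∶ ℕ ] ∁ (ρ-BC 𝒢 X (component-BC X (c (s at 0)) (s at 1)))) →
              A ≐ (⋃[ i ∶ ℕ ] ρ-BC 𝒢 X (c i))
      equal (A⊆ , ⊆A) =
        (λ a → let s , x∉ = A⊆ a in s at 0 , proj₂ (ρ-components X em (c (s at 0))) (s at 1 , x∉)) ,
        (λ { {x} (i , x∈) → let j , x∉ = proj₁ (ρ-components X em (c i)) x∈ in
             ⊆A (pair i j , subst₂ (λ i j → ¬ x ∈ ρ-BC 𝒢 X (component-BC X (c i) j))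
                                   (sym (pair-at-0 i j)) (sym (pair-at-1 i j)) x∉) })

    union-ρ : Clipped n β → ∀ {ζ} (c′ : union (n ∷ []) β ∈ BC 𝒢 ζ) → ρ-BC 𝒢 X c′ ≐ (⋃[ i ∶ ℕ ] ρ-BC 𝒢 X (c i))
    union-ρ clip c′ = [ (λ h → union-ρ-open clip h c′) , (λ h → union-ρ-limit h c′) ]′ (allOpen-or-someLimit (n ∷ []) β)

  -- Finite intersections.

  -- For t = ⟨ c , r , J , B ⟩ the ball with centre c and radius 1/(r+1) is
  -- enumerated if it is strongly inside ball (J)ᵢ of row i for all i ≤ n, as
  -- witnessed by (B)ᵢ.

  inside-each : RecursiveRel {4} (λ w →
    StronglyInside (ball (lookup w 2F at 0) (lookup w 2F at 1)) ((lookup w 2F at 3) at lookup w 1F) (lookup w 0F))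
  inside-each = stronglyInsideᴿ (ball-rec (proj 2F at-rec′ const 0) (proj 2F at-rec′ const 1))
    ((proj 2F at-rec′ const 3) at-rec′ proj 1F) (proj 0F)

  chosen-ball : Recursive {3} (λ w → ⟨ lookup w 0F , suc ((lookup w 1F at 2) at lookup w 0F) ⟩)
  chosen-ball = ⟨⟩-rec (proj 0F) (suc-rec ((proj 1F at-rec′ const 2) at-rec′ proj 0F))

  up-to′ : Recursive {2} (λ v → suc (lookup v 1F))
  up-to′ = suc-rec (proj 1F)

  inside-decision : ∀ v β → Everywhere inside-each chosen-ball up-to′ v β ⊎ Fails inside-each chosen-ball up-to′ v β
  inside-decision = decide inside-each chosen-ball up-to′

  openIntersection : Vec ℕ 1 → (ℕ → ℕ) → ℕ → ℕ
  -- The default 0 is the index of the empty ball.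
  openIntersection v β t = choose (inside-decision (t ∷ v) β) (ball (t at 0) (t at 1)) 0

  openIntersection-graph : Graph openIntersection
  openIntersection-graph = chooseˢ
    (∘ˢ (everywhereˢ inside-each chosen-ball up-to′) t∷v-rec) (∘ˢ (failsˢ inside-each chosen-ball up-to′) t∷v-rec)
    (λ w β → exclusive inside-each chosen-ball up-to′ (t∷v w) β)
    (λ w β → inside-decision (t∷v w) β)
    (recˢ (≡ᴿ (ball-rec (proj 0F at-rec′ const 0) (proj 0F at-rec′ const 1)) (proj 1F)))
    (recˢ (≡ᴿ (const 0) (proj 1F)))
    where
    t∷v : Vec ℕ 3 → Vec ℕ 2
    t∷v w = lookup w 0F ∷ tail (tail w)

    t∷v-rec : RecursiveVec t∷v
    t∷v-rec = ∷-rec (proj 0F) tail-rec₂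

  InsideAll : ℕ → (ℕ → ℕ) → ℕ → ℕ → ℕ → ℕ → Set
  InsideAll n β c r J B = ∀ i → i < suc n → StronglyInside (ball c r) (B at i) (β ⟨ i , suc (J at i) ⟩)

  N-openIntersection : ∀ n β t {x} → (x ∈ N X (openIntersection (n ∷ []) β t)) ⇔
    (InsideAll n β (t at 0) (t at 1) (t at 2) (t at 3) × x ∈ N X (ball (t at 0) (t at 1)))
  N-openIntersection n β t {x} = by (inside-decision (t ∷ n ∷ []) β) (exclusive inside-each chosen-ball up-to′ (t ∷ n ∷ []) β)
    where
    by : ∀ {A B : Set} (d : A ⊎ B) {l} → (A → ¬ B) → (x ∈ N X (choose d l 0)) ⇔ (A × x ∈ N X l)
    by (inj₁ a) excl = mk⇔ (a ,_) proj₂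
    by (inj₂ b) excl = mk⇔ (λ h → ⊥-elim (N-empty X h)) (λ { (a , _) → ⊥-elim (excl a b) })

  openIntersection-⊆ : ∀ n β t {x} → x ∈ N X (openIntersection (n ∷ []) β t) →
                       ∀ i → i < suc n → ∃[ j ] x ∈ N X (β ⟨ i , suc j ⟩)
  openIntersection-⊆ n β t h i i≤n =
    let inside , x∈ = to (N-openIntersection n β t) h
    in (t at 2) at i , inside⇒⊆ (ball (t at 0) (t at 1)) ((t at 3) at i) (β ⟨ i , suc ((t at 2) at i) ⟩) (inside i i≤n) x∈

  -- First a ball containing `x` is chosen in each row; each tolerates all balls around `x` below
  -- some size, uniformly. A single ball smaller than all these sizes is strongly inside every
  -- chosen one, and only then are the witnesses `B` collected.
  openIntersection-⊇ : ∀ n β {x} → (∀ i → i < suc n → ∃[ j ] x ∈ N X (β ⟨ i , suc j ⟩)) →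
                       ∃[ t ] x ∈ N X (openIntersection (n ∷ []) β t)
  openIntersection-⊇ n β {x} h =
    let J , J-spec = finite-choice (suc n) h
        E , E-spec = finite-choice (suc n) (λ i i≤n → small-balls-inside (β ⟨ i , suc (J i) ⟩) (J-spec i i≤n))
        r , E≤r    = finite-bound E (suc n)
        c , x∈     = ball-around x r
        B , B-spec = finite-choice (suc n) (λ i i≤n → E-spec i i≤n (ball c r)
                       (subst (ℚ._≤ 1 /1+ E i) (sym (radius-ball c r)) (1/1+-anti (E≤r i i≤n))) x∈)
        t , t₀ , t₁ , t₂ , t₃ = quadruple c r (encode (suc n) J) (encode (suc n) B)
    in t , from (N-openIntersection n β t) (recode t₀ t₁ t₂ t₃
      ( (λ i i≤n → subst₂ (λ b j → StronglyInside (ball c r) b (β ⟨ i , suc j ⟩))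
          (sym (at-encode (suc n) B i i≤n)) (sym (at-encode (suc n) J i i≤n)) (B-spec i i≤n))
      , x∈ ))
    where
    recode : ∀ {c r J B c′ r′ J′ B′} → c′ ≡ c → r′ ≡ r → J′ ≡ J → B′ ≡ B →
             InsideAll n β c r J B × x ∈ N X (ball c r) → InsideAll n β c′ r′ J′ B′ × x ∈ N X (ball c′ r′)
    recode refl refl refl refl p = p

  -- The sequence s selects a component of each row, and the s-th component
  -- of the intersection is the union of these.

  Selected : Vec ℕ 6 → (ℕ → ℕ) → Set
  Selected v β = Member β (π₁ (lookup v 0F) ⊓ lookup v 4F) (lookup v 5F at (π₁ (lookup v 0F) ⊓ lookup v 4F))
                          (π₂ (lookup v 0F)) (lookup v 1F)

  selectedˢ : SemiRecursive Selected
  selectedˢ = memberˢ row-rec (proj 5F at-rec′ row-rec) (comp₁ π₂ π₂-rec (proj 0F)) (proj 1F)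
    where
    row-rec : Recursive {6} (λ v → π₁ (lookup v 0F) ⊓ lookup v 4F)
    row-rec = ⊓-rec (comp₁ π₁ π₁-rec (proj 0F)) (proj 4F)

  UnionValue : Vec ℕ 4 → (ℕ → ℕ) → Set
  UnionValue v α = union (lookup v 2F ∷ []) α (lookup v 0F) ≡ lookup v 1F

  unionValueˢ : SemiRecursive UnionValue
  unionValueˢ = ∘ˢ union-graph (∷-rec (proj 0F) (∷-rec (proj 1F) (∷-rec (proj 2F) []-rec)))

  -- `union` is applied here to an oracle known only through `Selected`, so its values are expressed
  -- by substitution.
  intersectionMember : Σ[ f ∈ (Vec ℕ 1 → (ℕ → ℕ) → ℕ → ℕ) ] Σ[ _ ∈ Graph f ]
    (∀ n β s (δ : ℕ → ℕ) →
      (∀ m y → Substituted {P = UnionValue} {Selected} unionValueˢ (m ∷ y ∷ n ∷ s ∷ []) β ⇔ (δ m ≡ y)) →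
      Value 𝒢 ω 𝒩 (f (n ∷ []) β) s δ)
  intersectionMember = tabulated (substˢ {P = UnionValue} {Selected} unionValueˢ selectedˢ)

  intersection : Vec ℕ 1 → (ℕ → ℕ) → ℕ → ℕ
  intersection = assemble openIntersection (proj₁ intersectionMember)

  intersection-graph : Graph intersection
  intersection-graph = assemble-graph {o = openIntersection} {f = proj₁ intersectionMember}
    openIntersection-graph (proj₁ (proj₂ intersectionMember))

  module Intersection {n : ℕ} {β : ℕ → ℕ} {ξ : ℕ → Ord} (c : ∀ i → row β i ∈ BC 𝒢 (ξ i)) where

    -- The row index is clipped so that every selection satisfies `Clipped n`, as `Union.union-ρ`
    -- requires.
    selection : ℕ → ℕ → ℕ
    selection s q = component X (c (π₁ q ⊓ n)) (s at (π₁ q ⊓ n)) (π₂ q)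

    intersection-value : ∀ s → Value 𝒢 ω 𝒩 (proj₁ intersectionMember (n ∷ []) β) s (union (n ∷ []) (selection s))
    intersection-value s = proj₂ (proj₂ intersectionMember) n β s (union (n ∷ []) (selection s)) λ m y →
      substituted {P = UnionValue} {Selected} unionValueˢ {m ∷ y ∷ n ∷ s ∷ []} {β} {selection s}
        (λ q z → member β (π₁ q ⊓ n) (c (π₁ q ⊓ n)) (s at (π₁ q ⊓ n)) (π₂ q) z)

    row-selection : ∀ s i → row (selection s) i ≗ component X (c (i ⊓ n)) (s at (i ⊓ n))
    row-selection s i m = cong₂ (λ i m → component X (c (i ⊓ n)) (s at (i ⊓ n)) m) (π₁-⟨⟩ i m) (π₂-⟨⟩ i m)

    selection-clipped : ∀ s → Clipped n (selection s)
    selection-clipped s i m = trans (row-selection s i m) (trans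
      (cong (λ i → component X (c i) (s at i) m) (sym (⊓-idem i n))) (sym (row-selection s (i ⊓ n) m)))

    selection-BC : ∀ s i → row (selection s) i ∈ BC 𝒢 (rank X (c (i ⊓ n)) (s at (i ⊓ n)))
    selection-BC s i = BC-resp (sym ∘ row-selection s i) (component-BC X (c (i ⊓ n)) (s at (i ⊓ n)))

    -- If all selected components are open, the union is an open code of rank 1, which is below ζ by
    -- 2 ≤ ζ. Otherwise it has the rank μ of the highest selected component; being a maximum of
    -- finitely many ranks below ζ, μ is below ζ.
    selected-union-BC : ∀ {ζ} → (∀ i → ξ i ≤ₒ ζ) → 2ₒ ≤ₒ ζ → ∀ s →
                        ∃[ η ] ((1ₒ ≤ₒ η × η <ₒ ζ) × union (n ∷ []) (selection s) ∈ BC 𝒢 η)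
    selected-union-BC {ζ} ξ≤ζ 2≤ζ s =
      [ (λ h → 1ₒ , (≤ₒ-refl 1ₒ , 2≤ζ 0) , assemble-BC-open {o = openUnion} {proj₁ unionMember} h)
      , (λ h → μ , (≤ₒ-trans 1ₒ _ μ (proj₁ (bounds 0)) (ranks≤μ 0 z≤n) , μ<ζ) ,
               Union.union-BC-limit (selection-BC s) (λ i → ranks≤μ (i ⊓ n) (ℕ.m⊓n≤n i n)) h)
      ]′ (allOpen-or-someLimit (n ∷ []) (selection s))
      where
      bounds : ∀ i → 1ₒ ≤ₒ rank X (c i) (s at i) × rank X (c i) (s at i) <ₒ ζ
      bounds i = rank-bounds X (ξ≤ζ i) 2≤ζ (c i) (s at i)

      bounded : ∃[ μ ] (μ <ₒ ζ × (∀ i → i ≤ n → rank X (c i) (s at i) ≤ₒ μ))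
      bounded = finite-bound-below em {ζ} (λ i → rank X (c i) (s at i)) n (λ i _ → proj₂ (bounds i))

      μ       = proj₁ bounded
      μ<ζ     = proj₁ (proj₂ bounded)
      ranks≤μ = proj₂ (proj₂ bounded)

    intersection-BC-limit : ∀ {ζ} → (∀ i → ξ i ≤ₒ ζ) → SomeLimit n β → intersection (n ∷ []) β ∈ BC 𝒢 ζ
    intersection-BC-limit ξ≤ζ h = assemble-BC-limit {o = openIntersection} {proj₁ intersectionMember} h 2≤ζ
      intersection-value (selected-union-BC ξ≤ζ 2≤ζ)
      where
      2≤ζ = someLimit-rank n β c ξ≤ζ h

    intersection-ρ-open : AllOpen n β → ∀ {ζ} (c′ : intersection (n ∷ []) β ∈ BC 𝒢 ζ) →
                          ρ-BC 𝒢 X c′ ≐ (⋂[ i ∶ ℕ ] ρ-BC 𝒢 X (c (i ⊓ n)))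
    intersection-ρ-open h c′ = equal (assemble-ρ-open {o = openIntersection} {proj₁ intersectionMember} h c′)
      where
      row-ρ : ∀ i → i < suc n → ρ-BC 𝒢 X (c i) ≐ (⋃[ j ∶ ℕ ] N X (β ⟨ i , suc j ⟩))
      row-ρ i i≤n = ρ-open X (h i i≤n) (c i)

      equal : ∀ {A : Pred (Point X) 0ℓ} → A ≐ (⋃[ t ∶ ℕ ] N X (openIntersection (n ∷ []) β t)) →
              A ≐ (⋂[ i ∶ ℕ ] ρ-BC 𝒢 X (c (i ⊓ n)))
      equal (A⊆ , ⊆A) =
        (λ a i → let t , x∈ = A⊆ a ; i≤n = s≤s (ℕ.m⊓n≤n i n) in
           proj₂ (row-ρ (i ⊓ n) i≤n) (openIntersection-⊆ n β t x∈ (i ⊓ n) i≤n)) ,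
        (λ {x} x∈ → ⊆A (openIntersection-⊇ n β λ i i≤n → proj₁ (row-ρ i i≤n)
           (subst (λ i → x ∈ ρ-BC 𝒢 X (c i)) (ℕ.m≤n⇒m⊓n≡m (ℕ.≤-pred i≤n)) (x∈ i))))

    intersection-ρ-limit : ∀ {ζ} → (∀ i → ξ i ≤ₒ ζ) → SomeLimit n β →
                           ∀ {ζ′} (c′ : intersection (n ∷ []) β ∈ BC 𝒢 ζ′) →
                           ρ-BC 𝒢 X c′ ≐ (⋂[ i ∶ ℕ ] ρ-BC 𝒢 X (c (i ⊓ n)))
    intersection-ρ-limit ξ≤ζ h c′ = equal (assemble-ρ-limit {o = openIntersection} {proj₁ intersectionMember}
                                             h c′ intersection-value union-BC)
      where
      unions = selected-union-BC ξ≤ζ (someLimit-rank n β c ξ≤ζ h)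

      union-BC : ∀ s → union (n ∷ []) (selection s) ∈ BC 𝒢 (proj₁ (unions s))
      union-BC s = proj₂ (proj₂ (unions s))

      union-BC-ρ : ∀ s → ρ-BC 𝒢 X (union-BC s) ≐ (⋃[ i ∶ ℕ ] ρ-BC 𝒢 X (selection-BC s i))
      union-BC-ρ s = Union.union-ρ (selection-BC s) (selection-clipped s) (union-BC s)

      selected : ∀ s i → ρ-BC 𝒢 X (selection-BC s i) ≐ ρ-BC 𝒢 X (component-BC X (c (i ⊓ n)) (s at (i ⊓ n)))
      selected s i = ρ-unique X (row-selection s i) (selection-BC s i) member-BC ,
                     ρ-unique X (sym ∘ row-selection s i) member-BC (selection-BC s i)
        where
        member-BC = component-BC X (c (i ⊓ n)) (s at (i ⊓ n))

      equal : ∀ {A : Pred (Point X) 0ℓ} → A ≐ (⋃[ s ∶ ℕ ] ∁ (ρ-BC 𝒢 X (union-BC s))) →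
              A ≐ (⋂[ i ∶ ℕ ] ρ-BC 𝒢 X (c (i ⊓ n)))
      equal (A⊆ , ⊆A) =
        (λ a i → let s , x∉ = A⊆ a in proj₂ (ρ-components X em (c (i ⊓ n)))
           (s at (i ⊓ n) , λ x∈ → x∉ (proj₂ (union-BC-ρ s) (i , proj₂ (selected s i) x∈)))) ,
        (λ {x} x∈ → ⊆A (avoid x (finite-choice (suc n) (λ i i≤n → proj₁ (ρ-components X em (c i))
           (subst (λ i → x ∈ ρ-BC 𝒢 X (c i)) (ℕ.m≤n⇒m⊓n≡m (ℕ.≤-pred i≤n)) (x∈ i))))))
        where
        avoid : ∀ x → ∃[ J ] (∀ i → i < suc n → ¬ x ∈ ρ-BC 𝒢 X (component-BC X (c i) (J i))) →
                ∃[ s ] ¬ x ∈ ρ-BC 𝒢 X (union-BC s)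
        -- Only the choices for rows up to `n` are coded in `s`; this suffices because row `i` of
        -- the selection comes from row `i ⊓ n`.
        avoid x (J , x∉) = s , λ x∈ → let i , x∈i = proj₁ (union-BC-ρ s) x∈ ; i≤n = s≤s (ℕ.m⊓n≤n i n) in
          x∉ (i ⊓ n) i≤n (subst (λ j → x ∈ ρ-BC 𝒢 X (component-BC X (c (i ⊓ n)) j)) (at-encode (suc n) J (i ⊓ n) i≤n)
            (proj₁ (selected s i) x∈i))
          where
          s = encode (suc n) J

    intersection-ρ : ∀ {ζ} → (∀ i → ξ i ≤ₒ ζ) → ∀ {ζ′} (c′ : intersection (n ∷ []) β ∈ BC 𝒢 ζ′) →
                     ρ-BC 𝒢 X c′ ≐ (⋂[ i ∶ ℕ ] ρ-BC 𝒢 X (c (i ⊓ n)))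
    intersection-ρ ξ≤ζ c′ = [ (λ h → intersection-ρ-open h c′) , (λ h → intersection-ρ-limit ξ≤ζ h c′) ]′
                              (allOpen-or-someLimit (n ∷ []) β)

  -- Unions and intersections of columns

  finiteOperation : Fin 2 → Vec ℕ 1 → (ℕ → ℕ) → ℕ → ℕ
  finiteOperation = byBit intersection union

  module _ (ξ : Ord) (n : ℕ) (γ : ℕ → ℕ) (1≤ξ : 1ₒ ≤ₒ ξ)
           (codes : ∀ (i : Fin (suc n)) → column γ (toℕ i) ∈ BC 𝒢 1ₒ ∪ BC 𝒢 ξ) where

    private
      β : ℕ → ℕ
      β = columns n γ

    row≗column : ∀ i (j : Fin (suc n)) → i ⊓ n ≡ toℕ j → row β i ≗ column γ (toℕ j)
    row≗column i j e m = trans (row-columns n γ i m) (cong (λ i → column γ i m) e)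

    index : ℕ → Fin (suc n)
    index i = Fin.fromℕ< (s≤s (ℕ.m⊓n≤n i n))

    toℕ-index : ∀ i → i ⊓ n ≡ toℕ (index i)
    toℕ-index i = sym (Fin.toℕ-fromℕ< (s≤s (ℕ.m⊓n≤n i n)))

    rows : ∀ i → ∃[ η ] (η ≤ₒ ξ × row β i ∈ BC 𝒢 η)
    rows i = [ (λ c → 1ₒ , 1≤ξ , resp c) , (λ c → ξ , ≤ₒ-refl ξ , resp c) ]′ (codes (index i))
      where
      resp : ∀ {η} → column γ (toℕ (index i)) ∈ BC 𝒢 η → row β i ∈ BC 𝒢 η
      resp = BC-resp (sym ∘ row≗column i (index i) (toℕ-index i))

    row-BC : ∀ i → row β i ∈ BC 𝒢 (proj₁ (rows i))
    row-BC i = proj₂ (proj₂ (rows i))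

    row-rank : ∀ i → proj₁ (rows i) ≤ₒ ξ
    row-rank i = proj₁ (proj₂ (rows i))

    operation-open : AllOpen n β → ∀ a → finiteOperation a (n ∷ []) β ∈ BC 𝒢 1ₒ
    operation-open h 0F = assemble-BC-open {o = openIntersection} {proj₁ intersectionMember} h
    operation-open h 1F = assemble-BC-open {o = openUnion} {proj₁ unionMember} h

    operation-limit : SomeLimit n β → ∀ a → finiteOperation a (n ∷ []) β ∈ BC 𝒢 ξ
    operation-limit h 0F = Intersection.intersection-BC-limit row-BC row-rank h
    operation-limit h 1F = Union.union-BC-limit row-BC row-rank h

    operation-BC : ∀ a → finiteOperation a (n ∷ []) β ∈ BC 𝒢 1ₒ ∪ BC 𝒢 ξ
    operation-BC a = [ (λ h → inj₁ (operation-open h a)) , (λ h → inj₂ (operation-limit h a)) ]′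
                       (allOpen-or-someLimit (n ∷ []) β)

    -- For ξ ≥ 2 a member of BC_ξ has head 1, which rules out the open case.
    operation-BC-limit : ∀ a → 2ₒ ≤ₒ ξ → (∃[ i ] column γ (toℕ {suc n} i) ∈ BC 𝒢 ξ) →
                         finiteOperation a (n ∷ []) β ∈ BC 𝒢 ξ
    operation-BC-limit a 2≤ξ (i , c) =
      [ (λ h → ⊥-elim (head≢0 c (trans (sym (row≗column (toℕ i) i toℕi⊓n 0)) (allOpen-heads n β (columns-clipped n γ) h (toℕ i)))))
      , (λ h → operation-limit h a) ]′ (allOpen-or-someLimit (n ∷ []) β)
      where
      toℕi⊓n : toℕ i ⊓ n ≡ toℕ i
      toℕi⊓n = ℕ.m≤n⇒m⊓n≡m (ℕ.≤-pred (Fin.toℕ<n i))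

      head≢0 : ∀ {δ} → δ ∈ BC 𝒢 ξ → δ 0 ≢ 0
      head≢0 (base (ξ≤1 , _) _) _            = 2≰1 (≤ₒ-trans 2ₒ ξ 1ₒ 2≤ξ ξ≤1)
      head≢0 (limit _ δ1 _ _ _ _ _) δ0 = ℕ.0≢1+n (trans (sym δ0) δ1)

    module _ (c : ∀ (i : Fin (suc n)) → column γ (toℕ i) ∈ BorelCode 𝒢) where

      -- The theorem speaks of arbitrary proofs that the columns are codes, possibly at other ranks
      -- than in `row-BC`; `ρ-unique` reconciles them.
      row-ρ : ∀ i (j : Fin (suc n)) → i ⊓ n ≡ toℕ j → ρ-BC 𝒢 X (row-BC i) ≐ ρ 𝒢 X (c j)
      row-ρ i j e = ρ-unique X (row≗column i j e) (row-BC i) (proj₂ (proj₂ (c j))) ,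
                    ρ-unique X (sym ∘ row≗column i j e) (proj₂ (proj₂ (c j))) (row-BC i)

      column-ρ : ∀ (j : Fin (suc n)) → ρ-BC 𝒢 X (row-BC (toℕ j ⊓ n)) ≐ ρ 𝒢 X (c j)
      column-ρ j = row-ρ (toℕ j ⊓ n) j (trans (⊓-idem (toℕ j) n) (ℕ.m≤n⇒m⊓n≡m (ℕ.≤-pred (Fin.toℕ<n j))))

      intersection-of-columns : (c₀ : intersection (n ∷ []) β ∈ BorelCode 𝒢) →
                                ρ 𝒢 X c₀ ≐ (⋂[ i ∶ Fin (suc n) ] ρ 𝒢 X (c i))
      intersection-of-columns (_ , _ , c₀) =
        let ⊆rows , rows⊆ = Intersection.intersection-ρ row-BC row-rank c₀
        in (λ x∈ j → proj₁ (column-ρ j) (⊆rows x∈ (toℕ j))) ,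
           (λ x∈ → rows⊆ (λ i → proj₂ (row-ρ (i ⊓ n) (index i) (trans (⊓-idem i n) (toℕ-index i))) (x∈ (index i))))

      union-of-columns : (c₁ : union (n ∷ []) β ∈ BorelCode 𝒢) →
                         ρ 𝒢 X c₁ ≐ (⋃[ i ∶ Fin (suc n) ] ρ 𝒢 X (c i))
      union-of-columns (_ , _ , c₁) =
        let ⊆rows , rows⊆ = Union.union-ρ row-BC (columns-clipped n γ) c₁
        in (λ x∈ → let i , x∈i = ⊆rows x∈ in index i , proj₁ (row-ρ i (index i) (toℕ-index i)) x∈i) ,
           (λ { (j , x∈j) → rows⊆ (toℕ j ⊓ n , proj₂ (column-ρ j) x∈j) })

lemma3p5 :
    ExcludedMiddle 0ℓ → (𝒢 : GoodParametrization) (X : PolishSpace) →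
    Σ[ u ∈ (Point (𝟚 ⊗ ω ⊗ 𝒩) → Point 𝒩) ]
      RecursiveMap (𝟚 ⊗ ω ⊗ 𝒩) 𝒩 u ×
      (∀ (ξ : Ord) (a : Fin 2) (n : ℕ) (γ : ℕ → ℕ) → 1ₒ ≤ₒ ξ →
        (∀ (i : Fin (suc n)) → column γ (toℕ i) ∈ BC 𝒢 1ₒ ∪ BC 𝒢 ξ) →
        (u (a , n , γ) ∈ BC 𝒢 1ₒ ∪ BC 𝒢 ξ) ×
        (∀ (c : ∀ (i : Fin (suc n)) → column γ (toℕ i) ∈ BorelCode 𝒢)
           (c₀ : u (0F , n , γ) ∈ BorelCode 𝒢) (c₁ : u (1F , n , γ) ∈ BorelCode 𝒢) →
          (ρ 𝒢 X c₀ ≐ (⋂[ i ∶ Fin (suc n) ] ρ 𝒢 X (c i))) ×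
          (ρ 𝒢 X c₁ ≐ (⋃[ i ∶ Fin (suc n) ] ρ 𝒢 X (c i)))) ×
        (2ₒ ≤ₒ ξ → (∃[ i ] column γ (toℕ {suc n} i) ∈ BC 𝒢 ξ) → u (a , n , γ) ∈ BC 𝒢 ξ))
lemma3p5 em 𝒢 X =
  (λ { (a , n , γ) → finiteOperation a (n ∷ []) (columns n γ) }) ,
  by-bit-recursive {f = intersection} {union} intersection-graph union-graph ,
  λ ξ a n γ 1≤ξ codes →
    operation-BC ξ n γ 1≤ξ codes a ,
    (λ c c₀ c₁ → intersection-of-columns ξ n γ 1≤ξ codes c c₀ , union-of-columns ξ n γ 1≤ξ codes c c₁) ,
    operation-BC-limit ξ n γ 1≤ξ codes a
  where
  open Construction em 𝒢 X
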